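{- Let ${\sf Atomic}$ be the following formula about a countable partial order $P$ with bottom element $\bot$ (with $a,b,c$ ranging over $P$): $$\forall a\ \exists b\ \forall c\ \big[a>_P\bot\ \to\ (\bot<_P b\le_P a\ \wedge\ \neg(\bot<_P c<_P b))\big].$$ Then ${\sf Atomic}$ is $\forall\forall^\infty$-dicomplete.
   Context: Quantifiers range over $\omega$. $\exists^\infty n\,\varphi(n)$ means $\forall m\exists n\ge m\,\varphi(n)$ and $\forall^\infty n\,\varphi(n)$ means $\exists m\forall n\ge m\,\varphi(n)$. A quantifier-pattern is a finite string $\bar{\mathsf Q}=\mathsf Q_0\dots\mathsf Q_\ell$ over $\{\exists,\forall,\exists^\infty,\forall^\infty\}$. A $\bar{\mathsf Q}$-formula is $\varphi(\bar x)\equiv\mathsf Q_0n_0\dots\mathsf Q_\ell n_\ell\,\theta(n_0,\dots,n_\ell,\bar x)$ with $\theta$ a bounded formula. The instance $\bar x$ is a tuple of natural numbers and/or total computable functions (computable elements of $\omega^\omega$). Spaces such as $\omega\times\omega^\omega$, $(\omega^\omega)^\omega$, $\omega^{\omega\times\omega}$ are identified with $\omega^\omega$ by computable pairing. Witnesses: for $\alpha\in\omega^\omega$, $\alpha\Vdash\varphi(\bar x)$ ("$\alpha$ is a witness for $\varphi(\bar x)$") is defined by: $\alpha\Vdash\theta(\bar x)$ iff $\alpha=\bar x$ and $\theta(\bar x)$, for bounded $\theta$; $\langle t,\alpha\rangle\Vdash\exists n\varphi(n,\bar x)$ iff $\alpha\Vdash\varphi(t,\bar x)$; $\alpha\Vdash\forall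 n\varphi(n,\bar x)$ iff $\alpha(n)\Vdash\varphi(n,\bar x)$ for all $n$; $\langle t,\alpha\rangle\Vdash\forall^\infty n\varphi(n,\bar x)$ iff $\alpha(n)\Vdash\varphi(n,\bar x)$ for all $n\ge t$; $\alpha\Vdash\exists^\infty n\varphi(n,\bar x)$ iff for all $n$, writing $\alpha(n)=\langle k,\beta\rangle$, $k\ge n$ and $\beta\Vdash\varphi(k,\bar x)$. Reducibility: $\varphi\le_{\sf m}\psi$ if there are computable functions $\eta,r_-,r_+$ (type-two computable functionals, possibly partial but defined wherever required) such that for every instance $\bar x$: $\varphi(\bar x)$ is true iff $\psi(\eta(\bar x))$ is true; $\alpha\Vdash\varphi(\bar x)$ implies $r_-(\alpha,\bar x)\Vdash\psi(\eta(\bar x))$; $\alpha\Vdash\psi(\eta(\bar x))$ implies $r_+(\alpha,\bar x)\Vdash\varphi(\bar x)$ ($\alpha\in\omega^\omega$ arbitrary). The dual $\varphi^{\sf d}$ of $\mathsf Q_0n_0\dots\mathsf Q_\ell n_\ell\,\theta$ is $\mathsf Q_0^{\sf d}n_0\dots\mathsf Q_\ell^{\sf d}n_\ell\,\neg\theta$, where $\exists^{\sf d}=\forall$, $\forall^{\sf d}=\exists$, $(\exists^\infty)^{\sf d}=\forall^\infty$, $(\forall^\infty)^{\sf d}=\exists^\infty$. $\varphi\le_{\sf dm}\psi$ if $\varphi\le_{\sf m}\psi$ and $\varphi^{\sf d}\le_{\sf m}\psi^{\sf d}$ via a common $\eta$ (the $r_\pm$ may differ). $\varphi$ is strictly $\bar{\mathsf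 Q}$-dicomplete if it is a $\bar{\mathsf Q}$-formula and $\psi\le_{\sf dm}\varphi$ for every $\bar{\mathsf Q}$-formula $\psi$; it is $\bar{\mathsf Q}$-dicomplete if it is $\equiv_{\sf dm}$-equivalent to a strictly $\bar{\mathsf Q}$-dicomplete formula (one such is $\mathsf Q_0n_0\dots\mathsf Q_\ell n_\ell.\ x(n_0,\dots,n_\ell)=0$). Structures: a countable binary relation $(X,R)$, $X\subseteq\omega$, $R\subseteq X^2$, is coded by the pair of characteristic functions of $X$ and $R$, and is identified with its code; here the instance is a (computable) code of a partial order $P$ together with its bottom element $\bot$. Reductions from the problem need only work on such instances and reductions to it must output such instances. Quantifiers restricted to $P$ mean $\forall a(a\in P\to\cdots)$, $\exists a(a\in P\wedge\cdots)$, with these decidable conditions moved into the innermost bounded part. -}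

module Defs where

open import Data.Nat using (ℕ; zero; suc; _+_; _*_; _≤_; _<_)
open import Data.Fin using (Fin; zero; suc)
open import Data.Fin.Patterns using (0F; 1F; 2F; 3F)
open import Data.List using (List; []; _∷_)
open import Data.Product using (Σ; Σ-syntax; ∃-syntax; _×_; _,_; proj₁; uncurry)
open import Data.Sum using (_⊎_)
open import Data.Unit using (⊤)
open import Data.Vec using (Vec; []; _∷_; lookup)
open import Data.Vec.Relation.Binary.Pointwise.Inductive using (Pointwise)
open import Function using (_∘_; _on_; _⇔_)
open import Relation.Binary.Definitions using (Minimum)
open import Relation.Binary.PropositionalEquality using (_≡_; _≗_)
open import Relation.Binary.Structures using (IsPartialOrder)
open import Relation.Nullary using (¬_)

ω^ω : Set
ω^ω = ℕ → ℕ

------------------------------------------------------------------------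
-- Computable functionals: μ-recursive functions relative to k oracles.

data Code (k : ℕ) : ℕ → Set where
  zeroᶜ   : ∀ {n} → Code k n
  sucᶜ    : Code k 1
  projᶜ   : ∀ {n} → Fin n → Code k n
  oracleᶜ : Fin k → Code k 1
  compᶜ   : ∀ {m n} → Code k m → Vec (Code k n) m → Code k n
  precᶜ   : ∀ {n} → Code k n → Code k (2 + n) → Code k (1 + n)
  muᶜ     : ∀ {n} → Code k (1 + n) → Code k n

infix 3 _⊢_[_]⇓_ _⊢_↦_

-- Φ ⊢ e [ v ]⇓ r : the computation of e with oracles Φ on input v halts
-- with value r.
data _⊢_[_]⇓_ {k} (Φ : Vec ω^ω k) : ∀ {n} → Code k n → Vec ℕ n → ℕ → Set where
  ⇓zero   : ∀ {n} {v : Vec ℕ n} → Φ ⊢ zeroᶜ [ v ]⇓ 0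
  ⇓suc    : ∀ {x} → Φ ⊢ sucᶜ [ x ∷ [] ]⇓ suc x
  ⇓proj   : ∀ {n} {v : Vec ℕ n} i → Φ ⊢ projᶜ i [ v ]⇓ lookup v i
  ⇓oracle : ∀ {x} i → Φ ⊢ oracleᶜ i [ x ∷ [] ]⇓ lookup Φ i x
  ⇓comp   : ∀ {m n} {f : Code k m} {gs : Vec (Code k n) m} {v ws r} →
            Pointwise (λ g w → Φ ⊢ g [ v ]⇓ w) gs ws →
            Φ ⊢ f [ ws ]⇓ r →
            Φ ⊢ compᶜ f gs [ v ]⇓ r
  ⇓prec-0 : ∀ {n} {f : Code k n} {g v r} →
            Φ ⊢ f [ v ]⇓ r →
            Φ ⊢ precᶜ f g [ 0 ∷ v ]⇓ r
  ⇓prec-s : ∀ {n} {f : Code k n} {g v x r s} →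
            Φ ⊢ precᶜ f g [ x ∷ v ]⇓ r →
            Φ ⊢ g [ x ∷ r ∷ v ]⇓ s →
            Φ ⊢ precᶜ f g [ suc x ∷ v ]⇓ s
  ⇓mu     : ∀ {n} {f : Code k (1 + n)} {v x} →
            (∀ y → y < x → ∃[ r ] Φ ⊢ f [ y ∷ v ]⇓ suc r) →
            Φ ⊢ f [ x ∷ v ]⇓ 0 →
            Φ ⊢ muᶜ f [ v ]⇓ x

-- The (partial) functional with index e is defined at Φ with value β.
_⊢_↦_ : ∀ {k} → Vec ω^ω k → Code k 1 → ω^ω → Set
Φ ⊢ e ↦ β = ∀ n → Φ ⊢ e [ n ∷ [] ]⇓ β n

Computable : ω^ω → Set
Computable f = Σ[ e ∈ Code 0 1 ] [] ⊢ e ↦ f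

------------------------------------------------------------------------
-- Pairing and tupling

-- Cantor's bijection: pair m n = (m + n)(m + n + 1) / 2 + n.
triangle : ℕ → ℕ
triangle zero    = 0
triangle (suc n) = suc n + triangle n

pair : ℕ → ℕ → ℕ
pair m n = triangle (m + n) + n

-- The inverse of pair, walking along the diagonals.
unpair : ℕ → ℕ × ℕ
unpair zero    = 0 , 0
unpair (suc k) = next (unpair k)
  where
  next : ℕ × ℕ → ℕ × ℕ
  next (zero  , n) = suc n , 0
  next (suc m , n) = m , suc n

-- ω^ω ≅ ω × ω^ω: α = ⟨ head α , tail α ⟩.
head : ω^ω → ℕ
head α = α 0

tail : ω^ω → ω^ω
tail α = α ∘ suc

-- ω^ω ≅ (ω^ω)^ω: column α n is the function written α(n) when α is
-- regarded as a sequence of functions.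
column : ω^ω → ℕ → ω^ω
column α n m = α (pair n m)

-- Tuples of p natural numbers and q functions.
Tuple : ℕ → ℕ → Set
Tuple p q = Vec ℕ p × Vec ω^ω q

infixr 5 _◂_
_◂_ : ∀ {p q} → ℕ → Tuple p q → Tuple (suc p) q
n ◂ (ns , fs) = (n ∷ ns) , fs

rows : ∀ {q} → Vec ω^ω q → ℕ → ℕ → ℕ
rows []       i       j = 0
rows (f ∷ fs) zero    j = f j
rows (f ∷ fs) (suc i) j = rows fs i j

-- ω^p × (ω^ω)^q is identified with its image in ω^ω: the numbers come first,
-- followed by a function whose i-th column is the i-th function (and whose
-- columns of index ≥ q are 0).
encode : ∀ {p q} → Tuple p q → ω^ω
encode (n ∷ ns , fs) zero    = n
encode (n ∷ ns , fs) (suc m) = encode (ns , fs) m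
encode ([]     , fs) m       = uncurry (rows fs) (unpair m)

------------------------------------------------------------------------
-- Bounded formulas: first-order arithmetic with p number variables and q
-- function variables, all quantifiers being bounded by terms.

infix  9 _·_
infixl 7 _⊗_
infixl 6 _⊕_

data Term (p q : ℕ) : Set where
  var   : Fin p → Term p q
  num   : ℕ → Term p q
  _⊕_   : Term p q → Term p q → Term p q
  _⊗_   : Term p q → Term p q → Term p q
  -- Lets a function on ω × ω be applied to two arguments.
  ⟪_,_⟫ : Term p q → Term p q → Term p q
  _·_   : Fin q → Term p q → Term p q

infix  5 _≐_ _≼_
infix  4 ~_
infixr 3 _∧_
infixr 2 _∨_
infixr 1 _⇒_

data Bounded (p q : ℕ) : Set where
  _≐_ _≼_     : Term p q → Term p q → Bounded p q
  ~_          : Bounded p q → Bounded p q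
  _∧_ _∨_ _⇒_ : Bounded p q → Bounded p q → Bounded p q
  all< ex<    : Term p q → Bounded (suc p) q → Bounded p q

⟦_⟧ : ∀ {p q} → Term p q → Tuple p q → ℕ
⟦ var i ⟧     (ns , fs) = lookup ns i
⟦ num k ⟧     x         = k
⟦ s ⊕ t ⟧     x         = ⟦ s ⟧ x + ⟦ t ⟧ x
⟦ s ⊗ t ⟧     x         = ⟦ s ⟧ x * ⟦ t ⟧ x
⟦ ⟪ s , t ⟫ ⟧ x         = pair (⟦ s ⟧ x) (⟦ t ⟧ x)
⟦ i · t ⟧     (ns , fs) = lookup fs i (⟦ t ⟧ (ns , fs))

Holds : ∀ {p q} → Bounded p q → Tuple p q → Set
Holds (s ≐ t)    x = ⟦ s ⟧ x ≡ ⟦ t ⟧ x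
Holds (s ≼ t)    x = ⟦ s ⟧ x ≤ ⟦ t ⟧ x
Holds (~ θ)      x = ¬ Holds θ x
Holds (θ ∧ χ)    x = Holds θ x × Holds χ x
Holds (θ ∨ χ)    x = Holds θ x ⊎ Holds χ x
Holds (θ ⇒ χ)    x = Holds θ x → Holds χ x
Holds (all< t θ) x = ∀ k → k < ⟦ t ⟧ x → Holds θ (k ◂ x)
Holds (ex< t θ)  x = ∃[ k ] (k < ⟦ t ⟧ x × Holds θ (k ◂ x))

------------------------------------------------------------------------
-- Quantifier-patterns and formulas

data Quantifier : Set where
  ∃′ ∀′ ∃∞ ∀∞ : Quantifier

Pattern : Set
Pattern = List Quantifier

-- A Q̄-formula about p numbers and q functions.  A quantifier binds the
-- number variable 0 of its scope, so φ(n, x̄) is evaluated at n ◂ x̄.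
infixr 0 _∙_

data Formula (q : ℕ) : Pattern → ℕ → Set where
  matrix : ∀ {p} → Bounded p q → Formula q [] p
  _∙_    : ∀ {Qs p} (Q : Quantifier) → Formula q Qs (suc p) → Formula q (Q ∷ Qs) p

True : ∀ {q Qs p} → Formula q Qs p → Tuple p q → Set
True (matrix θ) x = Holds θ x
True (∃′ ∙ φ)   x = ∃[ n ] True φ (n ◂ x)
True (∀′ ∙ φ)   x = ∀ n → True φ (n ◂ x)
True (∃∞ ∙ φ)   x = ∀ m → ∃[ n ] (m ≤ n × True φ (n ◂ x))
True (∀∞ ∙ φ)   x = ∃[ m ] (∀ n → m ≤ n → True φ (n ◂ x))

-- Witness φ x α : α ⊩ φ(x)
Witness : ∀ {q Qs p} → Formula q Qs p → Tuple p q → ω^ω → Set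
Witness (matrix θ) x α = α ≗ encode x × Holds θ x
Witness (∃′ ∙ φ)   x α = Witness φ (head α ◂ x) (tail α)
Witness (∀′ ∙ φ)   x α = ∀ n → Witness φ (n ◂ x) (column α n)
Witness (∃∞ ∙ φ)   x α = ∀ n → n ≤ head (column α n) ×
                           Witness φ (head (column α n) ◂ x) (tail (column α n))
Witness (∀∞ ∙ φ)   x α = ∀ n → head α ≤ n → Witness φ (n ◂ x) (column (tail α) n)

dualQ : Quantifier → Quantifier
dualQ ∃′ = ∀′
dualQ ∀′ = ∃′
dualQ ∃∞ = ∀∞
dualQ ∀∞ = ∃∞

dualPattern : Pattern → Pattern
dualPattern []       = []
dualPattern (Q ∷ Qs) = dualQ Q ∷ dualPattern Qs

dualFormula : ∀ {q Qs p} → Formula q Qs p → Formula q (dualPattern Qs) p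
dualFormula (matrix θ) = matrix (~ θ)
dualFormula (Q ∙ φ)    = dualQ Q ∙ dualFormula φ

------------------------------------------------------------------------
-- Reducibility

-- A formula together with a restriction on the instances it is about (such
-- as being the code of a structure of a certain kind).
record Problem : Set₁ where
  constructor problem
  field
    {pattern′} : Pattern
    {p q}      : ℕ
    formula    : Formula q pattern′ p
    Domain     : Tuple p q → Set

open Problem

-- The problem given by a formula, with no restriction on its instances.
unrestricted : ∀ {q Qs p} → Formula q Qs p → Problem
unrestricted φ = problem φ (λ _ → ⊤)

dual : Problem → Problem
dual (problem φ D) = problem (dualFormula φ) D

Instance : (A : Problem) → Tuple (p A) (q A) → Set
Instance A (ns , fs) = (∀ i → Computable (lookup fs i)) × Domain A (ns , fs)

-- In reduce, y is the tuple η(x̄).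
infix 4 _≤m[_]_
record _≤m[_]_ (A : Problem) (η : Code 1 1) (B : Problem) : Set where
  field
    r₋ r₊  : Code 2 1
    reduce : ∀ x → Instance A x →
      Σ[ y ∈ Tuple (p B) (q B) ]
        ( (encode x ∷ [] ⊢ η ↦ encode y)
        × Instance B y
        × (True (formula A) x ⇔ True (formula B) y)
        × (∀ α → Witness (formula A) x α →
             Σ[ β ∈ ω^ω ] ((α ∷ encode x ∷ [] ⊢ r₋ ↦ β) × Witness (formula B) y β))
        × (∀ α → Witness (formula B) y α →
             Σ[ β ∈ ω^ω ] ((α ∷ encode x ∷ [] ⊢ r₊ ↦ β) × Witness (formula A) x β)))

infix 4 _≤dm_ _≡dm_

_≤dm_ : Problem → Problem → Set
A ≤dm B = Σ[ η ∈ Code 1 1 ] ((A ≤m[ η ] B) × (dual A ≤m[ η ] dual B))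

_≡dm_ : Problem → Problem → Set
A ≡dm B = A ≤dm B × B ≤dm A

StrictlyDicomplete : ∀ {q p} (Qs : Pattern) → Formula q Qs p → Set
StrictlyDicomplete Qs φ =
  ∀ {p′ q′} (ψ : Formula q′ Qs p′) → unrestricted ψ ≤dm unrestricted φ

Dicomplete : Pattern → Problem → Set
Dicomplete Qs A =
  ∃[ q ] ∃[ p ] Σ[ φ ∈ Formula q Qs p ]
    (StrictlyDicomplete Qs φ × A ≡dm unrestricted φ)

------------------------------------------------------------------------
-- Partial orders with a bottom element

-- X and R are characteristic functions (value 1 meaning membership), R being
-- a function on ω × ω.
record IsPointedPoset (⊥ : ℕ) (X R : ω^ω) : Set where
  field
    X-char : ∀ a → X a ≡ 0 ⊎ X a ≡ 1
    R-char : ∀ a b → R (pair a b) ≡ 0 ⊎ R (pair a b) ≡ 1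
    R⊆X²   : ∀ a b → R (pair a b) ≡ 1 → X a ≡ 1 × X b ≡ 1

  Carrier : Set
  Carrier = Σ[ a ∈ ℕ ] X a ≡ 1

  _≤P_ : Carrier → Carrier → Set
  (a , _) ≤P (b , _) = R (pair a b) ≡ 1

  field
    isPartialOrder : IsPartialOrder (_≡_ on proj₁) _≤P_
    ⊥∈X            : X ⊥ ≡ 1
    minimum        : Minimum _≤P_ (⊥ , ⊥∈X)

PointedPosetCode : Tuple 1 2 → Set
PointedPosetCode (⊥ ∷ [] , X ∷ R ∷ []) = IsPointedPoset ⊥ X R

Atomic : Problem
Atomic = problem
  (∀′ ∙ ∃′ ∙ ∀′ ∙ matrix
     (inP a ⇒ (inP b ∧ (inP c ⇒ (⊥ <P a ⇒ ((⊥ <P b ∧ b ≤P a) ∧ ~ (⊥ <P c ∧ c <P b)))))))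
  PointedPosetCode
  where
  a b c ⊥ : Term 4 2
  c = var 0F
  b = var 1F
  a = var 2F
  ⊥ = var 3F

  inP : Term 4 2 → Bounded 4 2
  inP s = 0F · s ≐ num 1

  infix 5 _≤P_ _<P_
  _≤P_ _<P_ : Term 4 2 → Term 4 2 → Bounded 4 2
  s ≤P t = 1F · ⟪ s , t ⟫ ≐ num 1
  s <P t = s ≤P t ∧ ~ (s ≐ t)

module Submission where

-- The formula ∀n ∀∞m. x ⟨ n , m ⟩ = 0 is complete since bounded formulas are
-- decidable.  It reduces to Atomic by making, for each n, a descending chain with
-- one more element for every m such that x ⟨ n , m ⟩ ≠ 0: there is an atom below
-- its top exactly if the chain is finite.
--
-- Conversely, given a poset, for each a we run through the candidates b for an
-- atom below a, passing to the next one when some c refutes the current one, and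
-- let x ⟨ a , k ⟩ ≠ 0 if the candidate is changed at stage k.  A bound for the last
-- change gives the final candidate.  In the other direction an atom below a alone
-- would not tell when smaller candidates are given up, but a witness for Atomic
-- assigns an atom s b below b to every b > ⊥, and s b ≠ b refutes b.  So the
-- stage of the last change is computable from the witness.

open import Data.Empty using (⊥-elim)
open import Data.Fin using (Fin; zero; suc; toℕ)
open import Data.Fin.Patterns using (0F; 1F; 2F)
open import Data.List using ([]; _∷_)
open import Data.Nat using (ℕ; zero; suc; pred; _+_; _*_; _∸_; _≤_; _<_; z≤n; s≤s)
open import Data.Nat.Properties
open import Data.Product using (∃-syntax; _×_; _,_; proj₁; proj₂)
open import Data.Sum using (_⊎_; inj₁; inj₂)
open import Data.Unit using (⊤; tt)
open import Data.Vec as Vec using (Vec; []; _∷_; lookup)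
open import Data.Vec.Relation.Binary.Pointwise.Inductive using (Pointwise; []; _∷_)
open import Function using (_∘_; mk⇔)
open import Relation.Binary.PropositionalEquality
open import Relation.Nullary using (¬_; yes; no; decidable-stable; ¬?; _×-dec_)
open import Defs

private
  variable
    I I′ : Set
    k k′ m n p q : ℕ
    Qs : Pattern

-- Pairing

unpair₁ unpair₂ : ℕ → ℕ
unpair₁ = proj₁ ∘ unpair
unpair₂ = proj₂ ∘ unpair

pair-suc : ∀ m n → pair m (suc n) ≡ suc (pair (suc m) n)
pair-suc m n rewrite +-suc m n = +-suc (triangle (suc (m + n))) n

pair-suc-zero : ∀ m → pair (suc m) 0 ≡ suc (pair 0 m)
pair-suc-zero m rewrite +-identityʳ m | +-identityʳ (m + triangle m) =
  cong suc (+-comm m (triangle m))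

-- Induction on the code rather than on `m` and `n`, because `unpair` recurses on it: the two lemmas
-- above give the predecessor of a code, within a diagonal and at the start of the next one.
unpair-pair : ∀ m n → unpair (pair m n) ≡ (m , n)
unpair-pair m n = go (pair m n) m n refl
  where
  go : ∀ k m n → pair m n ≡ k → unpair k ≡ (m , n)
  go zero    zero    zero    _  = refl
  go zero    (suc m) zero    ()
  go zero    m       (suc n) eq with () ← trans (sym eq) (pair-suc m n)
  go (suc k) m       (suc n) eq
    rewrite go k (suc m) n (suc-injective (trans (sym (pair-suc m n)) eq)) = refl
  go (suc k) (suc m) zero    eq
    rewrite go k zero m (suc-injective (trans (sym (pair-suc-zero m)) eq)) = refl

unpair₁-pair : ∀ m n → unpair₁ (pair m n) ≡ m
unpair₁-pair m n = cong proj₁ (unpair-pair m n)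

unpair₂-pair : ∀ m n → unpair₂ (pair m n) ≡ n
unpair₂-pair m n = cong proj₂ (unpair-pair m n)

pair-unpair : ∀ k → pair (unpair₁ k) (unpair₂ k) ≡ k
pair-unpair zero = refl
pair-unpair (suc k) with unpair k | pair-unpair k
... | zero  , n | eq = trans (pair-suc-zero n) (cong suc eq)
... | suc m , n | eq = trans (pair-suc m n) (cong suc eq)

-- Primitive recursive functionals

natrec : ℕ → (ℕ → ℕ → ℕ) → ℕ → ℕ
natrec z s zero    = z
natrec z s (suc n) = s n (natrec z s n)

-- A family of functions computed uniformly by one program; i ranges over the
-- instances, on which the oracles are Φ i.
record Comp (Φ : I → Vec ω^ω k) (F : I → Vec ℕ n → ℕ) : Set where
  constructor comp
  field
    code    : Code k n
    correct : ∀ i v → Φ i ⊢ code [ v ]⇓ F i v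

record Comps (Φ : I → Vec ω^ω k) (W : I → Vec ℕ n → Vec ℕ m) : Set where
  constructor comps
  field
    codes    : Vec (Code k n) m
    corrects : ∀ i v → Pointwise (λ g w → Φ i ⊢ g [ v ]⇓ w) codes (W i v)

-- Function-valued families are kept apart from numerical ones, the argument of the function being
-- the first input. With `lamᴾ` and `_$ᴾ_` passing between the two, functionals are written as
-- λ-terms whose variables `varᴾ` are de Bruijn indices.
record Compω (Φ : I → Vec ω^ω k) (G : I → Vec ℕ n → ω^ω) : Set where
  constructor compω
  field
    code    : Code k (suc n)
    correct : ∀ i v j → Φ i ⊢ code [ j ∷ v ]⇓ G i v j

open Comp
open Comps
open Compω renaming (code to codeω; correct to correctω)

private
  variable
    Φ : I → Vec ω^ω k
    Φ′ : I′ → Vec ω^ω k′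
    F F₁ F₂ : I → Vec ℕ n → ℕ
    G H : I → Vec ℕ n → ω^ω
    W : I → Vec ℕ n → Vec ℕ m

Comp-≗ : (∀ i v → F₁ i v ≡ F₂ i v) → Comp Φ F₁ → Comp Φ F₂
Comp-≗ eq (comp c ok) = comp c λ i v → subst (_ ⊢ c [ v ]⇓_) (eq i v) (ok i v)

Compω-≗ : (∀ i v j → G i v j ≡ H i v j) → Compω Φ G → Compω Φ H
Compω-≗ eq (compω c ok) =
  compω c λ i v j → subst (_ ⊢ c [ j ∷ v ]⇓_) (eq i v j) (ok i v j)

varᴾ : (i : Fin n) → Comp Φ (λ _ v → lookup v i)
varᴾ i = comp (projᶜ i) λ _ _ → ⇓proj i

[]ᴾ : {Φ : I → Vec ω^ω k} → Comps {n = n} Φ (λ _ _ → [])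
[]ᴾ = comps [] λ _ _ → []

infixr 5 _∷ᴾ_
_∷ᴾ_ : Comp Φ F → Comps Φ W → Comps Φ (λ i v → F i v ∷ W i v)
comp c ok ∷ᴾ comps cs oks = comps (c ∷ cs) λ i v → ok i v ∷ oks i v

infixl 9 _⟨_⟩
_⟨_⟩ : Comp Φ F → Comps Φ W → Comp Φ (λ i v → F i (W i v))
comp c ok ⟨ comps cs oks ⟩ =
  comp (compᶜ c cs) λ i v → ⇓comp (oks i v) (ok i _)

_⟨_⟩s : {V : I → Vec ℕ m → Vec ℕ p} → Comps Φ V → Comps Φ W → Comps Φ (λ i v → V i (W i v))
_⟨_⟩s {I} {m} {Φ = Φ} {W = W} (comps ds oks) (comps cs oks′) =
  comps (Vec.map (λ d → compᶜ d cs) ds) λ i v → go i v (oks i (W i v))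
  where
  go : ∀ i v {l} {ds : Vec (Code _ m) l} {us : Vec ℕ l} →
       Pointwise (λ g w → Φ i ⊢ g [ W i v ]⇓ w) ds us →
       Pointwise (λ g w → Φ i ⊢ g [ v ]⇓ w) (Vec.map (λ d → compᶜ d cs) ds) us
  go i v []         = []
  go i v (d⇓ ∷ ds⇓) = ⇓comp (oks′ i v) d⇓ ∷ go i v ds⇓

tailsᴾ : ∀ {n} {Φ : I → Vec ω^ω k} → Comps {n = suc n} Φ (λ _ v → Vec.tail v)
tailsᴾ {Φ = Φ} = comps (Vec.tabulate (projᶜ ∘ suc))
  λ { i (x ∷ v) → go i (x ∷ v) suc v λ _ → refl }
  where
  -- The recursion drops entries from the front, so the indices are given by an arbitrary map `f`
  -- instead of `suc`.
  go : ∀ {m l} i (v : Vec ℕ m) (f : Fin l → Fin m) (w : Vec ℕ l) →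
       (∀ j → lookup v (f j) ≡ lookup w j) →
       Pointwise (λ g r → Φ i ⊢ g [ v ]⇓ r) (Vec.tabulate (projᶜ ∘ f)) w
  go i v f []      eq = []
  go i v f (x ∷ w) eq =
    subst (_ ⊢ projᶜ (f zero) [ v ]⇓_) (eq zero) (⇓proj (f zero)) ∷ go i v (f ∘ suc) w (eq ∘ suc)

idsᴾ : ∀ {n} {Φ : I → Vec ω^ω k} → Comps {n = n} Φ (λ _ v → v)
idsᴾ {n = zero}          = comps [] λ { _ [] → [] }
idsᴾ {n = suc n} {Φ = Φ} = comps (projᶜ zero ∷ codes (tailsᴾ {Φ = Φ}))
  λ { i (x ∷ v) → ⇓proj zero ∷ corrects (tailsᴾ {Φ = Φ}) i (x ∷ v) }

↑_ : Comp Φ F → Comp Φ (λ i v → F i (Vec.tail v))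
↑ c = c ⟨ tailsᴾ ⟩

sucᴾ : Comp Φ F → Comp Φ (λ i v → suc (F i v))
sucᴾ (comp c ok) = comp (compᶜ sucᶜ (c ∷ [])) λ i v → ⇓comp (ok i v ∷ []) ⇓suc

constᴾ : ∀ (a : ℕ) {Φ : I → Vec ω^ω k} → Comp {n = n} Φ (λ _ _ → a)
constᴾ zero    = comp zeroᶜ λ _ _ → ⇓zero
constᴾ (suc a) = sucᴾ (constᴾ a)

lamᴾ : {F : I → Vec ℕ (suc n) → ℕ} → Comp Φ F → Compω Φ (λ i v j → F i (j ∷ v))
lamᴾ (comp c ok) = compω c λ i v j → ok i (j ∷ v)

infixl 8 _$ᴾ_
_$ᴾ_ : Compω Φ G → Comp Φ F → Comp Φ (λ i v → G i v (F i v))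
_$ᴾ_ {Φ = Φ} (compω c ok) (comp d ok′) = comp (compᶜ c (d ∷ codes (idsᴾ {Φ = Φ})))
  λ i v → ⇓comp (ok′ i v ∷ corrects (idsᴾ {Φ = Φ}) i v) (ok i v _)

infixl 9 _⟨_⟩ω
_⟨_⟩ω : Compω Φ G → Comps Φ W → Compω Φ (λ i v → G i (W i v))
compω c ok ⟨ ws ⟩ω with comps cs oks ← ws ⟨ tailsᴾ ⟩s =
  compω (compᶜ c (projᶜ zero ∷ cs)) λ i v j → ⇓comp (⇓proj zero ∷ oks i (j ∷ v)) (ok i _ j)

oracleᴾ : ∀ (o : Fin k) {Φ : I → Vec ω^ω k} → Compω {n = n} Φ (λ i _ → lookup (Φ i) o)
oracleᴾ o = compω (compᶜ (oracleᶜ o) (projᶜ zero ∷ [])) λ i v j → ⇓comp (⇓proj zero ∷ []) (⇓oracle o)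

natrecᴾ : {G : I → Vec ℕ (2 + n) → ℕ} → Comp Φ F → Comp Φ G → Comp Φ F₁ →
          Comp Φ (λ i v → natrec (F i v) (λ x r → G i (x ∷ r ∷ v)) (F₁ i v))
natrecᴾ {Φ = Φ} {F = F} {G = G} (comp c ok) (comp d ok′) t = compω (precᶜ c d) go $ᴾ t
  where
  go : ∀ i v j → Φ i ⊢ precᶜ c d [ j ∷ v ]⇓ natrec (F i v) (λ x r → G i (x ∷ r ∷ v)) j
  go i v zero    = ⇓prec-0 (ok i v)
  go i v (suc j) = ⇓prec-s (go i v j) (ok′ i _)

-- Arithmetic

natrec-+ : ∀ a b → natrec b (λ _ r → suc r) a ≡ a + b
natrec-+ zero    b = refl
natrec-+ (suc a) b = cong suc (natrec-+ a b)

natrec-* : ∀ a b → natrec 0 (λ _ r → b + r) a ≡ a * b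
natrec-* zero    b = refl
natrec-* (suc a) b = cong (b +_) (natrec-* a b)

natrec-pred : ∀ a → natrec 0 (λ x _ → x) a ≡ pred a
natrec-pred zero    = refl
natrec-pred (suc a) = refl

natrec-∸ : ∀ a b → natrec a (λ _ r → pred r) b ≡ a ∸ b
natrec-∸ a zero    = refl
natrec-∸ a (suc b) = trans (cong pred (natrec-∸ a b)) (pred[m∸n]≡m∸[1+n] a b)

natrec-triangle : ∀ a → natrec 0 (λ x r → suc x + r) a ≡ triangle a
natrec-triangle zero    = refl
natrec-triangle (suc a) = cong (suc a +_) (natrec-triangle a)

infixl 6 _+ᴾ_ _∸ᴾ_
infixl 7 _*ᴾ_

_+ᴾ_ : Comp Φ F₁ → Comp Φ F₂ → Comp Φ (λ i v → F₁ i v + F₂ i v)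
_+ᴾ_ {F₁ = F₁} {F₂ = F₂} c d =
  Comp-≗ (λ i v → natrec-+ (F₁ i v) (F₂ i v)) (natrecᴾ d (sucᴾ (varᴾ 1F)) c)

_*ᴾ_ : Comp Φ F₁ → Comp Φ F₂ → Comp Φ (λ i v → F₁ i v * F₂ i v)
_*ᴾ_ {F₁ = F₁} {F₂ = F₂} c d =
  Comp-≗ (λ i v → natrec-* (F₁ i v) (F₂ i v)) (natrecᴾ (constᴾ 0) (↑ ↑ d +ᴾ varᴾ 1F) c)

predᴾ : Comp Φ F → Comp Φ (λ i v → pred (F i v))
predᴾ {F = F} c = Comp-≗ (λ i v → natrec-pred (F i v)) (natrecᴾ (constᴾ 0) (varᴾ 0F) c)

_∸ᴾ_ : Comp Φ F₁ → Comp Φ F₂ → Comp Φ (λ i v → F₁ i v ∸ F₂ i v)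
_∸ᴾ_ {F₁ = F₁} {F₂ = F₂} c d =
  Comp-≗ (λ i v → natrec-∸ (F₁ i v) (F₂ i v)) (natrecᴾ c (predᴾ (varᴾ 1F)) d)

triangleᴾ : Comp Φ F → Comp Φ (λ i v → triangle (F i v))
triangleᴾ {F = F} c = Comp-≗ (λ i v → natrec-triangle (F i v))
  (natrecᴾ (constᴾ 0) (sucᴾ (varᴾ 0F) +ᴾ varᴾ 1F) c)

pairᴾ : Comp Φ F₁ → Comp Φ F₂ → Comp Φ (λ i v → pair (F₁ i v) (F₂ i v))
pairᴾ c d = triangleᴾ (c +ᴾ d) +ᴾ d

-- The index of the diagonal containing k; it increases from k to k + 1 exactly
-- when the first component of unpair k is 0.
diagonal : ℕ → ℕ
diagonal = natrec 0 λ k d → d + (1 ∸ (d ∸ (k ∸ triangle d)))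

-- `unpair` recurses on pairs, which is not an instance of `natrec`. Both components are recovered
-- from one number, since `diagonal k` equals `unpair₁ k + unpair₂ k`.
unpair-diagonal : ∀ k → let d = diagonal k in
  unpair₂ k ≡ k ∸ triangle d × unpair₁ k ≡ d ∸ (k ∸ triangle d)
unpair-diagonal k = second , first
  where
  second′ : ∀ k → k ∸ triangle (unpair₁ k + unpair₂ k) ≡ unpair₂ k
  second′ k = trans (cong (_∸ triangle d) (sym (pair-unpair k))) (m+n∸m≡n (triangle d) _)
    where d = unpair₁ k + unpair₂ k

  first′ : ∀ k → let d = unpair₁ k + unpair₂ k in d ∸ (k ∸ triangle d) ≡ unpair₁ k
  first′ k = trans (cong (unpair₁ k + unpair₂ k ∸_) (second′ k)) (m+n∸n≡m (unpair₁ k) (unpair₂ k))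

  unpair-suc : ∀ k → unpair₁ (suc k) + unpair₂ (suc k) ≡ unpair₁ k + unpair₂ k + (1 ∸ unpair₁ k)
  unpair-suc k with unpair k
  ... | zero  , n = trans (+-identityʳ (suc n)) (+-comm 1 n)
  ... | suc m , n rewrite 0∸n≡0 m | +-identityʳ (m + n) = +-suc m n

  diagonal-sum : ∀ k → diagonal k ≡ unpair₁ k + unpair₂ k
  diagonal-sum zero    = refl
  diagonal-sum (suc k) rewrite diagonal-sum k | first′ k = sym (unpair-suc k)

  second : unpair₂ k ≡ k ∸ triangle (diagonal k)
  second rewrite diagonal-sum k = sym (second′ k)

  first : unpair₁ k ≡ diagonal k ∸ (k ∸ triangle (diagonal k))
  first rewrite diagonal-sum k = sym (first′ k)

diagonalᴾ : Comp Φ F → Comp Φ (λ i v → diagonal (F i v))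
diagonalᴾ = natrecᴾ (constᴾ 0) (d +ᴾ (constᴾ 1 ∸ᴾ (d ∸ᴾ (varᴾ 0F ∸ᴾ triangleᴾ d))))
  where
  d : ∀ {n} {Φ : I → Vec ω^ω k} → Comp {n = 2 + n} Φ (λ _ v → lookup v 1F)
  d = varᴾ 1F

unpair₂ᴾ : Comp Φ F → Comp Φ (λ i v → unpair₂ (F i v))
unpair₂ᴾ {F = F} c = Comp-≗ (λ i v → sym (proj₁ (unpair-diagonal (F i v))))
  (c ∸ᴾ triangleᴾ (diagonalᴾ c))

unpair₁ᴾ : Comp Φ F → Comp Φ (λ i v → unpair₁ (F i v))
unpair₁ᴾ {F = F} c = Comp-≗ (λ i v → sym (proj₂ (unpair-diagonal (F i v))))
  (diagonalᴾ c ∸ᴾ (c ∸ᴾ triangleᴾ (diagonalᴾ c)))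

-- Substitution of programs for oracles

substCode  : (Fin k → Code k′ 1) → Code k n → Code k′ n
substCodes : (Fin k → Code k′ 1) → Vec (Code k n) m → Vec (Code k′ n) m

substCode σ zeroᶜ       = zeroᶜ
substCode σ sucᶜ        = sucᶜ
substCode σ (projᶜ i)   = projᶜ i
substCode σ (oracleᶜ o) = σ o
substCode σ (compᶜ c cs) = compᶜ (substCode σ c) (substCodes σ cs)
substCode σ (precᶜ c d) = precᶜ (substCode σ c) (substCode σ d)
substCode σ (muᶜ c)     = muᶜ (substCode σ c)

substCodes σ []       = []
substCodes σ (c ∷ cs) = substCode σ c ∷ substCodes σ cs

module _ {Φ : Vec ω^ω k} {Φ′ : Vec ω^ω k′} (σ : Fin k → Code k′ 1)
         (σ⇓ : ∀ o → Φ′ ⊢ σ o ↦ lookup Φ o) where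

  substCode-⇓ : ∀ {c : Code k n} {v r} → Φ ⊢ c [ v ]⇓ r → Φ′ ⊢ substCode σ c [ v ]⇓ r
  substCodes-⇓ : ∀ {cs : Vec (Code k n) m} {v rs} →
                 Pointwise (λ c r → Φ ⊢ c [ v ]⇓ r) cs rs →
                 Pointwise (λ c r → Φ′ ⊢ c [ v ]⇓ r) (substCodes σ cs) rs

  substCode-⇓ ⇓zero          = ⇓zero
  substCode-⇓ ⇓suc           = ⇓suc
  substCode-⇓ (⇓proj i)      = ⇓proj i
  substCode-⇓ (⇓oracle o)    = σ⇓ o _
  substCode-⇓ (⇓comp cs⇓ c⇓) = ⇓comp (substCodes-⇓ cs⇓) (substCode-⇓ c⇓)
  substCode-⇓ (⇓prec-0 c⇓)   = ⇓prec-0 (substCode-⇓ c⇓)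
  substCode-⇓ (⇓prec-s r⇓ d⇓) = ⇓prec-s (substCode-⇓ r⇓) (substCode-⇓ d⇓)
  substCode-⇓ (⇓mu below⇓ c⇓) =
    ⇓mu (λ y y<x → proj₁ (below⇓ y y<x) , substCode-⇓ (proj₂ (below⇓ y y<x))) (substCode-⇓ c⇓)

  substCodes-⇓ []         = []
  substCodes-⇓ (c⇓ ∷ cs⇓) = substCode-⇓ c⇓ ∷ substCodes-⇓ cs⇓

-- Composition of functionals: the oracles of one program are answered by other programs. It runs a
-- reduction on data that are themselves computed, and removes the oracles altogether when the data
-- are computable.
substω : (g : I′ → I) → (∀ o → Compω {n = 0} Φ′ (λ i _ → lookup (Φ (g i)) o)) →
         Compω Φ G → Compω Φ′ (λ i → G (g i))
substω g σ (compω c ok) = compω (substCode (codeω ∘ σ) c)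
  λ i v j → substCode-⇓ (codeω ∘ σ) (λ o j → correctω (σ o) i [] j) (ok (g i) v j)

NoOracles : ⊤ → Vec ω^ω 0
NoOracles _ = []

computable⇒Compω : ∀ {f} → Computable f → Compω {n = 0} NoOracles (λ _ _ → f)
computable⇒Compω (c , ok) = compω c λ { _ [] j → ok j }

Compω⇒computable : ∀ {f} → Compω {n = 0} NoOracles (λ _ _ → f) → Computable f
Compω⇒computable (compω c ok) = c , ok tt []

-- Sequences and tuples

gather : (ℕ → ω^ω) → ω^ω
gather g k = g (unpair₁ k) (unpair₂ k)

cons : ℕ → ω^ω → ω^ω
cons a γ zero    = a
cons a γ (suc j) = γ j

column-gather : ∀ g n → column (gather g) n ≗ g n
column-gather g n j rewrite unpair-pair n j = refl

cons-encode : ∀ a (x : Tuple p q) {γ} → γ ≗ encode x → cons a γ ≗ encode (a ◂ x)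
cons-encode a x eq zero    = refl
cons-encode a x eq (suc j) = eq j

gatherᴾ : {G : I → Vec ℕ (suc n) → ω^ω} → Compω Φ G →
          Compω Φ (λ i v → gather (λ m → G i (m ∷ v)))
gatherᴾ c = lamᴾ (c ⟨ unpair₁ᴾ (varᴾ 0F) ∷ᴾ tailsᴾ ⟩ω $ᴾ unpair₂ᴾ (varᴾ 0F))

-- Case distinction is a `natrec` whose step ignores the recursive value.
consᴾ : Comp Φ F → Compω Φ G → Compω Φ (λ i v → cons (F i v) (G i v))
consᴾ {F = F} {G = G} c d = Compω-≗ eq
  (lamᴾ (natrecᴾ (↑ c) (d ⟨ tailsᴾ ⟨ tailsᴾ ⟨ tailsᴾ ⟩s ⟩s ⟩ω $ᴾ varᴾ 0F) (varᴾ 0F)))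
  where
  eq : ∀ i v j → natrec (F i v) (λ x _ → G i v x) j ≡ cons (F i v) (G i v) j
  eq i v zero    = refl
  eq i v (suc j) = refl

lookup-tail : ∀ {A : Set} (w : Vec A (suc n)) j → lookup w (suc j) ≡ lookup (Vec.tail w) j
lookup-tail (_ ∷ _) j = refl

Comps-≗ : {V : I → Vec ℕ n → Vec ℕ m} → (∀ i v → V i v ≡ W i v) → Comps Φ V → Comps Φ W
Comps-≗ eq (comps cs oks) = comps cs λ i v → subst (Pointwise _ cs) (eq i v) (oks i v)

tabulateᴾ : ∀ {m} (W : I → Vec ℕ n → Vec ℕ m) →
            (∀ j → Comp Φ (λ i v → lookup (W i v) j)) → Comps Φ W
tabulateᴾ {m = zero}  W c = Comps-≗ (λ i v → nil (W i v)) []ᴾ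
  where
  nil : ∀ (w : Vec ℕ 0) → [] ≡ w
  nil [] = refl
tabulateᴾ {m = suc m} W c = Comps-≗ (λ i v → eta (W i v))
  (c 0F ∷ᴾ tabulateᴾ (λ i v → Vec.tail (W i v))
             (λ j → Comp-≗ (λ i v → lookup-tail (W i v) j) (c (suc j))))
  where
  eta : ∀ (w : Vec ℕ (suc m)) → lookup w 0F ∷ Vec.tail w ≡ w
  eta (_ ∷ _) = refl

-- Each of the finitely many functions has its own program, so the row index is resolved by `q`
-- nested case distinctions.
rowsᴾ : ∀ (fs : I → Vec ω^ω q) → (∀ o → Compω {n = 0} Φ (λ i _ → lookup (fs i) o)) →
        Compω {n = 1} Φ (λ i v → rows (fs i) (Vec.head v))
rowsᴾ {q = zero} fs _ = Compω-≗ (λ i v j → eq (fs i) (Vec.head v) j) (lamᴾ (constᴾ 0))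
  where
  eq : ∀ (gs : Vec ω^ω 0) l j → 0 ≡ rows gs l j
  eq [] l j = refl
rowsᴾ {q = suc q} {Φ = Φ} fs c = Compω-≗ (λ { i (l ∷ []) j → eq (fs i) l j })
  (lamᴾ (natrecᴾ (c 0F ⟨ []ᴾ ⟩ω $ᴾ varᴾ 0F)
                 (rowsᴾ (Vec.tail ∘ fs) c-tail ⟨ varᴾ 0F ∷ᴾ []ᴾ ⟩ω $ᴾ varᴾ 2F)
                 (varᴾ 1F)))
  where
  c-tail : ∀ o → Compω {n = 0} Φ (λ i _ → lookup (Vec.tail (fs i)) o)
  c-tail o = Compω-≗ (λ i _ j → cong (λ f → f j) (lookup-tail (fs i) o)) (c (suc o))

  eq : ∀ (gs : Vec ω^ω (suc q)) l j →
       natrec (lookup gs 0F j) (λ x _ → rows (Vec.tail gs) x j) l ≡ rows gs l j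
  eq (_ ∷ _) zero    j = refl
  eq (_ ∷ _) (suc l) j = refl

encodeᴾ : ∀ (x : I → Tuple p q) →
          (∀ j → Comp {n = 0} Φ (λ i _ → lookup (proj₁ (x i)) j)) →
          (∀ o → Compω {n = 0} Φ (λ i _ → lookup (proj₂ (x i)) o)) →
          Compω {n = 0} Φ (λ i _ → encode (x i))
encodeᴾ {p = zero} x _ d = Compω-≗ (λ i _ j → eq (x i) j) (gatherᴾ (rowsᴾ (proj₂ ∘ x) d))
  where
  eq : ∀ (y : Tuple zero _) j → gather (rows (proj₂ y)) j ≡ encode y j
  eq ([] , fs) j = refl
encodeᴾ {p = suc p} {Φ = Φ} x c d = Compω-≗ (λ i _ → eq (x i))
  (consᴾ (c 0F) (encodeᴾ (λ i → Vec.tail (proj₁ (x i)) , proj₂ (x i)) c-tail d))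
  where
  c-tail : ∀ j → Comp {n = 0} Φ (λ i _ → lookup (Vec.tail (proj₁ (x i))) j)
  c-tail j = Comp-≗ (λ i _ → lookup-tail (proj₁ (x i)) j) (c (suc j))

  eq : ∀ (y : Tuple (suc p) _) →
       cons (lookup (proj₁ y) 0F) (encode (Vec.tail (proj₁ y) , proj₂ y)) ≗ encode y
  eq (n ∷ ns , fs) = cons-encode n (ns , fs) λ _ → refl

encode-number : ∀ (x : Tuple p q) i → encode x (toℕ i) ≡ lookup (proj₁ x) i
encode-number (n ∷ ns , fs) zero    = refl
encode-number (n ∷ ns , fs) (suc i) = encode-number (ns , fs) i

rows-lookup : ∀ (fs : Vec ω^ω q) o j → rows fs (toℕ o) j ≡ lookup fs o j
rows-lookup (f ∷ fs) zero    j = refl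
rows-lookup (f ∷ fs) (suc o) j = rows-lookup fs o j

encode-function : ∀ (x : Tuple p q) o j →
                  encode x (p + pair (toℕ o) j) ≡ lookup (proj₂ x) o j
encode-function (n ∷ ns , fs) o j = encode-function (ns , fs) o j
encode-function ([]     , fs) o j rewrite unpair-pair (toℕ o) j = rows-lookup fs o j

numberᴾ : ∀ (x : I → Tuple p q) → Compω {n = 0} Φ (λ i _ → encode (x i)) →
          ∀ j → Comp {n = 0} Φ (λ i _ → lookup (proj₁ (x i)) j)
numberᴾ x c j = Comp-≗ (λ i _ → encode-number (x i) j) (c $ᴾ constᴾ (toℕ j))

functionᴾ : ∀ (x : I → Tuple p q) → Compω {n = 0} Φ (λ i _ → encode (x i)) →
            ∀ o → Compω {n = 0} Φ (λ i _ → lookup (proj₂ (x i)) o)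
functionᴾ {p = p} x c o = Compω-≗ (λ i _ → encode-function (x i) o)
  (lamᴾ (c ⟨ []ᴾ ⟩ω $ᴾ (constᴾ p +ᴾ pairᴾ (constᴾ (toℕ o)) (varᴾ 0F))))

parametersᴾ : ∀ (x : I → Tuple p q) → Compω {n = 0} Φ (λ i _ → encode (x i)) →
              Comps {n = n} Φ (λ i _ → proj₁ (x i))
parametersᴾ x c = tabulateᴾ _ (λ j → numberᴾ x c j ⟨ []ᴾ ⟩)

-- Truth values of bounded formulas, 0 meaning truth

sumBelow prodBelow : ℕ → ω^ω → ℕ
sumBelow  t f = natrec 0 (λ k r → r + f k) t
prodBelow t f = natrec 1 (λ k r → r * f k) t

sumBelow≡0⇒ : ∀ t f → sumBelow t f ≡ 0 → ∀ k → k < t → f k ≡ 0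
sumBelow≡0⇒ (suc t) f eq k (s≤s k≤t) with m≤n⇒m<n∨m≡n k≤t
... | inj₁ k<t  = sumBelow≡0⇒ t f (m+n≡0⇒m≡0 (sumBelow t f) eq) k k<t
... | inj₂ refl = m+n≡0⇒n≡0 (sumBelow t f) eq

⇒sumBelow≡0 : ∀ t f → (∀ k → k < t → f k ≡ 0) → sumBelow t f ≡ 0
⇒sumBelow≡0 zero    f h = refl
⇒sumBelow≡0 (suc t) f h =
  cong₂ _+_ (⇒sumBelow≡0 t f λ k k<t → h k (m<n⇒m<1+n k<t)) (h t ≤-refl)

term≤sumBelow : ∀ t f {k} → k < t → f k ≤ sumBelow t f
term≤sumBelow (suc t) f (s≤s k≤t) with m≤n⇒m<n∨m≡n k≤t
... | inj₁ k<t  = ≤-trans (term≤sumBelow t f k<t) (m≤m+n (sumBelow t f) (f t))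
... | inj₂ refl = m≤n+m (f t) (sumBelow t f)

prodBelow≡0⇒ : ∀ t f → prodBelow t f ≡ 0 → ∃[ k ] (k < t × f k ≡ 0)
prodBelow≡0⇒ (suc t) f eq with m*n≡0⇒m≡0∨n≡0 (prodBelow t f) eq
... | inj₁ eq′ = let k , k<t , fk≡0 = prodBelow≡0⇒ t f eq′ in k , m<n⇒m<1+n k<t , fk≡0
... | inj₂ ft≡0 = t , ≤-refl , ft≡0

⇒prodBelow≡0 : ∀ t f k → k < t → f k ≡ 0 → prodBelow t f ≡ 0
⇒prodBelow≡0 (suc t) f k (s≤s k≤t) fk≡0 with m≤n⇒m<n∨m≡n k≤t
... | inj₁ k<t  = cong (_* f t) (⇒prodBelow≡0 t f k k<t fk≡0)
... | inj₂ refl = trans (cong (prodBelow t f *_) fk≡0) (*-zeroʳ (prodBelow t f))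

sumBelowᴾ : Compω Φ G → Comp Φ F → Comp Φ (λ i v → sumBelow (F i v) (G i v))
sumBelowᴾ c d = natrecᴾ (constᴾ 0) (varᴾ 1F +ᴾ (c ⟨ tailsᴾ ⟨ tailsᴾ ⟩s ⟩ω $ᴾ varᴾ 0F)) d

prodBelowᴾ : Compω Φ G → Comp Φ F → Comp Φ (λ i v → prodBelow (F i v) (G i v))
prodBelowᴾ c d = natrecᴾ (constᴾ 1) (varᴾ 1F *ᴾ (c ⟨ tailsᴾ ⟨ tailsᴾ ⟩s ⟩ω $ᴾ varᴾ 0F)) d

-- With 0 as truth, addition is conjunction and multiplication is disjunction, and the values can
-- serve directly as the sequence that the complete formula tests for 0.
truth : Bounded p q → Tuple p q → ℕ
truth (s ≐ t)    x = (⟦ s ⟧ x ∸ ⟦ t ⟧ x) + (⟦ t ⟧ x ∸ ⟦ s ⟧ x)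
truth (s ≼ t)    x = ⟦ s ⟧ x ∸ ⟦ t ⟧ x
truth (~ θ)      x = 1 ∸ truth θ x
truth (θ ∧ χ)    x = truth θ x + truth χ x
truth (θ ∨ χ)    x = truth θ x * truth χ x
truth (θ ⇒ χ)    x = (1 ∸ truth θ x) * truth χ x
truth (all< t θ) x = sumBelow (⟦ t ⟧ x) (λ k → truth θ (k ◂ x))
truth (ex< t θ)  x = prodBelow (⟦ t ⟧ x) (λ k → truth θ (k ◂ x))

1∸n≡0⇒n≢0 : ∀ {n} → 1 ∸ n ≡ 0 → n ≢ 0
1∸n≡0⇒n≢0 () refl

n≢0⇒1∸n≡0 : ∀ {n} → n ≢ 0 → 1 ∸ n ≡ 0
n≢0⇒1∸n≡0 {zero}  n≢0 = ⊥-elim (n≢0 refl)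
n≢0⇒1∸n≡0 {suc n} _   = 0∸n≡0 n

-- The two directions are proved together, because negation and the premise of an implication
-- exchange them.
truth⇒Holds : ∀ (θ : Bounded p q) x → truth θ x ≡ 0 → Holds θ x
Holds⇒truth : ∀ (θ : Bounded p q) x → Holds θ x → truth θ x ≡ 0

truth⇒Holds (s ≐ t) x eq = ≤-antisym
  (m∸n≡0⇒m≤n (m+n≡0⇒m≡0 (⟦ s ⟧ x ∸ ⟦ t ⟧ x) eq))
  (m∸n≡0⇒m≤n (m+n≡0⇒n≡0 (⟦ s ⟧ x ∸ ⟦ t ⟧ x) eq))
truth⇒Holds (s ≼ t) x eq = m∸n≡0⇒m≤n eq
truth⇒Holds (~ θ)   x eq h = 1∸n≡0⇒n≢0 eq (Holds⇒truth θ x h)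
truth⇒Holds (θ ∧ χ) x eq =
  truth⇒Holds θ x (m+n≡0⇒m≡0 (truth θ x) eq) , truth⇒Holds χ x (m+n≡0⇒n≡0 (truth θ x) eq)
truth⇒Holds (θ ∨ χ) x eq with m*n≡0⇒m≡0∨n≡0 (truth θ x) eq
... | inj₁ eq′ = inj₁ (truth⇒Holds θ x eq′)
... | inj₂ eq′ = inj₂ (truth⇒Holds χ x eq′)
truth⇒Holds (θ ⇒ χ) x eq h with m*n≡0⇒m≡0∨n≡0 (1 ∸ truth θ x) eq
... | inj₁ eq′ = ⊥-elim (1∸n≡0⇒n≢0 eq′ (Holds⇒truth θ x h))
... | inj₂ eq′ = truth⇒Holds χ x eq′
truth⇒Holds (all< t θ) x eq k k<t =
  truth⇒Holds θ (k ◂ x) (sumBelow≡0⇒ (⟦ t ⟧ x) _ eq k k<t)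
truth⇒Holds (ex< t θ) x eq =
  let k , k<t , eq′ = prodBelow≡0⇒ (⟦ t ⟧ x) _ eq in k , k<t , truth⇒Holds θ (k ◂ x) eq′

Holds⇒truth (s ≐ t) x eq rewrite eq | n∸n≡0 (⟦ t ⟧ x) = refl
Holds⇒truth (s ≼ t) x s≤t = m≤n⇒m∸n≡0 s≤t
Holds⇒truth (~ θ)   x ¬h = n≢0⇒1∸n≡0 (¬h ∘ truth⇒Holds θ x)
Holds⇒truth (θ ∧ χ) x (h , h′) = cong₂ _+_ (Holds⇒truth θ x h) (Holds⇒truth χ x h′)
Holds⇒truth (θ ∨ χ) x (inj₁ h) = cong (_* truth χ x) (Holds⇒truth θ x h)
Holds⇒truth (θ ∨ χ) x (inj₂ h) =
  trans (cong (truth θ x *_) (Holds⇒truth χ x h)) (*-zeroʳ (truth θ x))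
Holds⇒truth (θ ⇒ χ) x h with truth θ x ≟ 0
... | yes eq = trans (cong ((1 ∸ truth θ x) *_) (Holds⇒truth χ x (h (truth⇒Holds θ x eq))))
                     (*-zeroʳ (1 ∸ truth θ x))
... | no neq = cong (_* truth χ x) (n≢0⇒1∸n≡0 neq)
Holds⇒truth (all< t θ) x h =
  ⇒sumBelow≡0 (⟦ t ⟧ x) _ λ k k<t → Holds⇒truth θ (k ◂ x) (h k k<t)
Holds⇒truth (ex< t θ) x (k , k<t , h) =
  ⇒prodBelow≡0 (⟦ t ⟧ x) _ k k<t (Holds⇒truth θ (k ◂ x) h)

module _ {I : Set} {k} {Φ : I → Vec ω^ω k} (fs : I → Vec ω^ω q)
         (f : ∀ o → Compω {n = 0} Φ (λ i _ → lookup (fs i) o)) where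

  termᴾ : (t : Term p q) → Comp Φ (λ i v → ⟦ t ⟧ (v , fs i))
  termᴾ (var i)   = varᴾ i
  termᴾ (num a)   = constᴾ a
  termᴾ (s ⊕ t)   = termᴾ s +ᴾ termᴾ t
  termᴾ (s ⊗ t)   = termᴾ s *ᴾ termᴾ t
  termᴾ ⟪ s , t ⟫ = pairᴾ (termᴾ s) (termᴾ t)
  termᴾ (o · t)   = f o ⟨ []ᴾ ⟩ω $ᴾ termᴾ t

  truthᴾ : (θ : Bounded p q) → Comp Φ (λ i v → truth θ (v , fs i))
  truthᴾ (s ≐ t)    = (termᴾ s ∸ᴾ termᴾ t) +ᴾ (termᴾ t ∸ᴾ termᴾ s)
  truthᴾ (s ≼ t)    = termᴾ s ∸ᴾ termᴾ t
  truthᴾ (~ θ)      = constᴾ 1 ∸ᴾ truthᴾ θ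
  truthᴾ (θ ∧ χ)    = truthᴾ θ +ᴾ truthᴾ χ
  truthᴾ (θ ∨ χ)    = truthᴾ θ *ᴾ truthᴾ χ
  truthᴾ (θ ⇒ χ)    = (constᴾ 1 ∸ᴾ truthᴾ θ) *ᴾ truthᴾ χ
  truthᴾ (all< t θ) = sumBelowᴾ (lamᴾ (truthᴾ θ)) (termᴾ t)
  truthᴾ (ex< t θ)  = prodBelowᴾ (lamᴾ (truthᴾ θ)) (termᴾ t)

-- Witnesses and Skolem functions

-- Columns of a gathered sequence agree with the given functions only pointwise, so witnesses have
-- to be transported along `≗`.
Witness-cong : ∀ (φ : Formula q Qs p) {x α β} → α ≗ β → Witness φ x α → Witness φ x β
Witness-cong (matrix θ) α≗β (α≗x , h) = (λ j → trans (sym (α≗β j)) (α≗x j)) , h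
Witness-cong (∃′ ∙ φ) {β = β} α≗β w rewrite α≗β 0 = Witness-cong φ (α≗β ∘ suc) w
Witness-cong (∀′ ∙ φ) α≗β w n = Witness-cong φ (λ j → α≗β (pair n j)) (w n)
Witness-cong (∃∞ ∙ φ) α≗β w n with w n
... | n≤k , w′ rewrite α≗β (pair n 0) = n≤k , Witness-cong φ (λ j → α≗β (pair n (suc j))) w′
Witness-cong (∀∞ ∙ φ) α≗β w n t≤n =
  Witness-cong φ (λ j → α≗β (suc (pair n j))) (w n (≤-trans (≤-reflexive (α≗β 0)) t≤n))

gather-witness-∀ : ∀ (φ : Formula q Qs (suc p)) {x} g →
                   (∀ n → Witness φ (n ◂ x) (g n)) → Witness (∀′ ∙ φ) x (gather g)
gather-witness-∀ φ g w n = Witness-cong φ (sym ∘ column-gather g n) (w n)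

gather-witness-∃∞ : ∀ (φ : Formula q Qs (suc p)) {x} (t : ω^ω) (γ : ℕ → ω^ω) →
                    (∀ n → n ≤ t n × Witness φ (t n ◂ x) (γ n)) →
                    Witness (∃∞ ∙ φ) x (gather λ n → cons (t n) (γ n))
gather-witness-∃∞ φ {x} t γ w n =
    subst (n ≤_) (sym head≡) (proj₁ (w n))
  , subst (λ a → Witness φ (a ◂ x) (tail (column (gather δ) n))) (sym head≡)
      (Witness-cong φ (λ j → sym (column-gather δ n (suc j))) (proj₂ (w n)))
  where
  δ : ℕ → ω^ω
  δ n = cons (t n) (γ n)

  head≡ : head (column (gather δ) n) ≡ t n
  head≡ = column-gather δ n 0

gather-witness-∀∞ : ∀ (φ : Formula q Qs (suc p)) {x} t g →
                    (∀ n → t ≤ n → Witness φ (n ◂ x) (g n)) →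
                    Witness (∀∞ ∙ φ) x (cons t (gather g))
gather-witness-∀∞ φ t g w n t≤n = Witness-cong φ (sym ∘ column-gather g n) (w n t≤n)

-- A witness is, up to computable translations, a Skolem function.  For a
-- formula beginning with ∃ its first value instantiates that quantifier.
record Skolemization (φ : Formula q Qs p) : Set₁ where
  field
    Skolem     : Tuple p q → ω^ω → Set
    true       : ∀ {x s} → Skolem x s → True φ x
    skolem     : ∀ {x} → True φ x → ∃[ s ] Skolem x s
    extract    : ω^ω → ω^ω
    extract-ok : ∀ {x α} → Witness φ x α → Skolem x (extract α)
    build      : ω^ω → ω^ω → ω^ω
    build-ok   : ∀ {x s} → Skolem x s → Witness φ x (build s (encode x))
    extractᴾ   : ∀ {I : Set} {k} {Φ : I → Vec ω^ω k} {α : I → ω^ω} →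
                 Compω {n = 0} Φ (λ i _ → α i) → Compω {n = 0} Φ (λ i _ → extract (α i))
    buildᴾ     : ∀ {I : Set} {k} {Φ : I → Vec ω^ω k} {s e : I → ω^ω} →
                 Compω {n = 0} Φ (λ i _ → s i) → Compω {n = 0} Φ (λ i _ → e i) →
                 Compω {n = 0} Φ (λ i _ → build (s i) (e i))

open Skolemization

-- Position `pair n 0` is the head of column `n`, where a witness keeps the number chosen by an `∃′`
-- or `∀∞` below an outer `∀′`, or by an `∃∞` itself.
choices : ω^ω → ω^ω
choices α n = α (pair n 0)

choicesᴾ : ∀ {α : I → ω^ω} → Compω {n = 0} Φ (λ i _ → α i) →
           Compω {n = 0} Φ (λ i _ → choices (α i))
choicesᴾ c = lamᴾ (c ⟨ []ᴾ ⟩ω $ᴾ pairᴾ (varᴾ 0F) (constᴾ 0))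

tailᴾ : Compω Φ G → Compω Φ (λ i v → tail (G i v))
tailᴾ c = lamᴾ (c ⟨ tailsᴾ ⟩ω $ᴾ sucᴾ (varᴾ 0F))

-- Besides the choices a witness contains only encoded tuples, as the witness of a matrix is its
-- instance. These are restored by `build` from `e`, the code of the parameters.
skolem-∀∀∞ : (θ : Bounded (2 + p) q) → Skolemization (∀′ ∙ ∀∞ ∙ matrix θ)
skolem-∀∀∞ θ = record
  { Skolem     = λ x s → ∀ n m → s n ≤ m → Holds θ (m ◂ n ◂ x)
  ; true       = λ {_} {s} h n → s n , h n
  ; skolem     = λ h → proj₁ ∘ h , proj₂ ∘ h
  ; extract    = choices
  ; extract-ok = λ w n m s≤m → proj₂ (w n m s≤m)
  ; build      = λ s e → gather (δ s e)
  ; build-ok   = λ {x} {s} h → gather-witness-∀ (∀∞ ∙ matrix θ) (δ s (encode x)) λ n →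
      gather-witness-∀∞ (matrix θ) (s n) (λ m → cons m (cons n (encode x))) λ m s≤m →
        cons-encode m (n ◂ x) (cons-encode n x (λ _ → refl)) , h n m s≤m
  ; extractᴾ   = choicesᴾ
  ; buildᴾ     = λ s e → gatherᴾ (consᴾ (s ⟨ []ᴾ ⟩ω $ᴾ varᴾ 0F)
      (gatherᴾ (consᴾ (varᴾ 0F) (consᴾ (varᴾ 1F) (e ⟨ []ᴾ ⟩ω)))))
  }
  where
  δ : ω^ω → ω^ω → ℕ → ω^ω
  δ s e n = cons (s n) (gather λ m → cons m (cons n e))

skolem-∃∃∞ : (θ : Bounded (2 + p) q) → Skolemization (∃′ ∙ ∃∞ ∙ matrix θ)
skolem-∃∃∞ θ = record
  { Skolem     = λ x s → ∀ k → k ≤ tail s k × Holds θ (tail s k ◂ head s ◂ x)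
  ; true       = λ {_} {s} h → head s , λ k → tail s k , h k
  ; skolem     = λ (a , h) → cons a (proj₁ ∘ h) , proj₂ ∘ h
  ; extract    = λ α → cons (head α) (choices (tail α))
  ; extract-ok = λ w k → proj₁ (w k) , proj₂ (proj₂ (w k))
  ; build      = λ s e → cons (head s)
      -- The chosen number occurs twice: as the choice for `∃∞` and as the first entry of the
      -- encoded tuple.
      (gather λ k → cons (tail s k) (cons (tail s k) (cons (head s) e)))
  ; build-ok   = λ {x} {s} h → gather-witness-∃∞ (matrix θ) (tail s)
      (λ k → cons (tail s k) (cons (head s) (encode x))) λ k →
      proj₁ (h k) ,
      cons-encode (tail s k) (head s ◂ x) (cons-encode (head s) x (λ _ → refl)) ,
      proj₂ (h k)
  ; extractᴾ   = λ α → consᴾ (α $ᴾ constᴾ 0) (choicesᴾ (tailᴾ α))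
  ; buildᴾ     = λ s e → consᴾ (s $ᴾ constᴾ 0)
      (gatherᴾ (consᴾ (tailᴾ s ⟨ []ᴾ ⟩ω $ᴾ varᴾ 0F) (consᴾ (tailᴾ s ⟨ []ᴾ ⟩ω $ᴾ varᴾ 0F)
        (consᴾ (s ⟨ []ᴾ ⟩ω $ᴾ constᴾ 0) (e ⟨ []ᴾ ⟩ω)))))
  }

skolem-∀∃∀ : (θ : Bounded (3 + p) q) → Skolemization (∀′ ∙ ∃′ ∙ ∀′ ∙ matrix θ)
skolem-∀∃∀ θ = record
  { Skolem     = λ x s → ∀ a c → Holds θ (c ◂ s a ◂ a ◂ x)
  ; true       = λ {_} {s} h a → s a , h a
  ; skolem     = λ h → proj₁ ∘ h , proj₂ ∘ h
  ; extract    = choices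
  ; extract-ok = λ w a c → proj₂ (w a c)
  ; build      = λ s e → gather (δ s e)
  ; build-ok   = λ {x} {s} h → gather-witness-∀ (∃′ ∙ ∀′ ∙ matrix θ) (δ s (encode x)) λ a →
      gather-witness-∀ (matrix θ) (λ c → cons c (cons (s a) (cons a (encode x)))) λ c →
        cons-encode c (s a ◂ a ◂ x)
          (cons-encode (s a) (a ◂ x) (cons-encode a x (λ _ → refl))) ,
        h a c
  ; extractᴾ   = choicesᴾ
  ; buildᴾ     = λ s e → gatherᴾ (consᴾ (s ⟨ []ᴾ ⟩ω $ᴾ varᴾ 0F)
      (gatherᴾ (consᴾ (varᴾ 0F) (consᴾ (s ⟨ []ᴾ ⟩ω $ᴾ varᴾ 1F)
        (consᴾ (varᴾ 1F) (e ⟨ []ᴾ ⟩ω))))))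
  }
  where
  δ : ω^ω → ω^ω → ℕ → ω^ω
  δ s e a = cons (s a) (gather λ c → cons c (cons (s a) (cons a e)))

skolem-∃∀∃ : (θ : Bounded (3 + p) q) → Skolemization (∃′ ∙ ∀′ ∙ ∃′ ∙ matrix θ)
skolem-∃∀∃ θ = record
  { Skolem     = λ x s → ∀ b → Holds θ (tail s b ◂ b ◂ head s ◂ x)
  ; true       = λ {_} {s} h → head s , λ b → tail s b , h b
  ; skolem     = λ (a , h) → cons a (proj₁ ∘ h) , proj₂ ∘ h
  ; extract    = λ α → cons (head α) (choices (tail α))
  ; extract-ok = λ w b → proj₂ (w b)
  ; build      = λ s e → cons (head s)
      (gather λ b → cons (tail s b) (cons (tail s b) (cons b (cons (head s) e))))
  ; build-ok   = λ {x} {s} h → gather-witness-∀ (∃′ ∙ matrix θ)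
      (λ b → cons (tail s b) (cons (tail s b) (cons b (cons (head s) (encode x))))) λ b →
        cons-encode (tail s b) (b ◂ head s ◂ x)
          (cons-encode b (head s ◂ x) (cons-encode (head s) x (λ _ → refl))) ,
        h b
  ; extractᴾ   = λ α → consᴾ (α $ᴾ constᴾ 0) (choicesᴾ (tailᴾ α))
  ; buildᴾ     = λ s e → consᴾ (s $ᴾ constᴾ 0)
      (gatherᴾ (consᴾ (tailᴾ s ⟨ []ᴾ ⟩ω $ᴾ varᴾ 0F) (consᴾ (tailᴾ s ⟨ []ᴾ ⟩ω $ᴾ varᴾ 0F)
        (consᴾ (varᴾ 0F) (consᴾ (s ⟨ []ᴾ ⟩ω $ᴾ constᴾ 0) (e ⟨ []ᴾ ⟩ω))))))
  }

-- Reductions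

encode-computable : ∀ (x : Tuple p q) → (∀ o → Computable (lookup (proj₂ x) o)) →
                    Compω {n = 0} NoOracles (λ _ _ → encode x)
encode-computable x c = encodeᴾ (λ _ → x) (λ j → constᴾ (lookup (proj₁ x) j))
  (computable⇒Compω ∘ c)

Instanceᴼ : Tuple p q → Vec ω^ω 1
Instanceᴼ x = encode x ∷ []

Skolemᴼ : ω^ω × Tuple p q → Vec ω^ω 2
Skolemᴼ (s , x) = s ∷ encode x ∷ []

-- It suffices to translate Skolem functions: a witness is extracted, translated and rebuilt. Since
-- truth is constructive it yields a Skolem function, not necessarily computable, so the same
-- translations also show that truth is preserved in both directions.
module _ {A B : Problem}
         (SA : Skolemization (Problem.formula A)) (SB : Skolemization (Problem.formula B))
         (y : Tuple (Problem.p A) (Problem.q A) → Tuple (Problem.p B) (Problem.q B))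
         (yᴾ : Compω {n = 0} Instanceᴼ (λ x _ → encode (y x)))
         (y-domain : ∀ x → Problem.Domain A x → Problem.Domain B (y x))
         {r₋ r₊ : ω^ω → Tuple (Problem.p A) (Problem.q A) → ω^ω}
         (r₋ᴾ : Compω {n = 0} Skolemᴼ (λ (s , x) _ → r₋ s x))
         (r₊ᴾ : Compω {n = 0} Skolemᴼ (λ (s , x) _ → r₊ s x))
         (r₋-ok : ∀ x s → Problem.Domain A x → Skolem SA x s → Skolem SB (y x) (r₋ s x))
         (r₊-ok : ∀ x s → Problem.Domain A x → Skolem SB (y x) s → Skolem SA x (r₊ s x))
         where

  private
    module A = Problem A
    module B = Problem B

    y-instance : ∀ x → Instance A x → Instance B (y x)
    y-instance x (c , d) =
      -- The functions of `x` are computable and its numbers are constants, so the oracle of the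
      -- program for `y` can be replaced by a program.
      (λ o → Compω⇒computable (functionᴾ (λ _ → y x) (substω (λ _ → x) x-computable yᴾ) o)) ,
      y-domain x d
      where
      x-computable : ∀ o → Compω {n = 0} NoOracles (λ _ _ → lookup (Instanceᴼ x) o)
      x-computable 0F = encode-computable x c

    αᴾ : Compω {n = 0} (Skolemᴼ {A.p} {A.q}) (λ (α , _) _ → α)
    αᴾ = oracleᴾ 0F

    xᴾ : Compω {n = 0} (Skolemᴼ {A.p} {A.q}) (λ (_ , x) _ → encode x)
    xᴾ = oracleᴾ 1F

    encode-yᴾ : Compω {n = 0} (Skolemᴼ {A.p} {A.q}) (λ (_ , x) _ → encode (y x))
    encode-yᴾ = substω proj₂ (λ { 0F → xᴾ }) yᴾ

    r₋-onᴾ : Compω {n = 0} Skolemᴼ (λ (α , x) _ → r₋ (extract SA α) x)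
    r₋-onᴾ = substω (λ (α , x) → extract SA α , x)
      (λ { 0F → extractᴾ SA αᴾ ; 1F → xᴾ }) r₋ᴾ

    r₊-onᴾ : Compω {n = 0} Skolemᴼ (λ (α , x) _ → r₊ (extract SB α) x)
    r₊-onᴾ = substω (λ (α , x) → extract SB α , x)
      (λ { 0F → extractᴾ SB αᴾ ; 1F → xᴾ }) r₊ᴾ

    w₋ᴾ : Compω {n = 0} Skolemᴼ (λ (α , x) _ → build SB (r₋ (extract SA α) x) (encode (y x)))
    w₋ᴾ = buildᴾ SB r₋-onᴾ encode-yᴾ

    w₊ᴾ : Compω {n = 0} Skolemᴼ (λ (α , x) _ → build SA (r₊ (extract SB α) x) (encode x))
    w₊ᴾ = buildᴾ SA r₊-onᴾ xᴾ

  skolem-reduction : A ≤m[ codeω yᴾ ] B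
  skolem-reduction = record
    { r₋ = codeω w₋ᴾ
    ; r₊ = codeω w₊ᴾ
    ; reduce = λ x inst@(_ , d) →
          y x
        , correctω yᴾ x []
        , y-instance x inst
        , mk⇔ (λ h → let s , h′ = skolem SA h in true SB (r₋-ok x s d h′))
              (λ h → let s , h′ = skolem SB h in true SA (r₊-ok x s d h′))
        , (λ α w → _ , correctω w₋ᴾ (α , x) [] , build-ok SB (r₋-ok x _ d (extract-ok SA w)))
        , (λ α w → _ , correctω w₊ᴾ (α , x) [] , build-ok SA (r₊-ok x _ d (extract-ok SB w)))
    }

-- A complete formula

everywhere0-eventually : Formula 1 (∀′ ∷ ∀∞ ∷ []) 0
everywhere0-eventually = ∀′ ∙ ∀∞ ∙ matrix (0F · ⟪ var 1F , var 0F ⟫ ≐ num 0)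

gathered : (ℕ → ω^ω) → Tuple 0 1
gathered h = [] , gather h ∷ []

gatheredᴾ : ∀ (h : I → ℕ → ω^ω) → Compω {n = 1} Φ (λ i v → h i (lookup v 0F)) →
            Compω {n = 0} Φ (λ i _ → encode (gathered (h i)))
gatheredᴾ h c = encodeᴾ (gathered ∘ h) (λ ()) (λ { 0F → gatherᴾ c })

-- The sequence consists of the truth values of the matrix, so a Skolem function for one formula is
-- one for the other, unchanged; the same holds for the duals.
everywhere0-eventually-complete : StrictlyDicomplete (∀′ ∷ ∀∞ ∷ []) everywhere0-eventually
everywhere0-eventually-complete {p} {q} (∀′ ∙ ∀∞ ∙ matrix θ) =
    codeω yᴾ
  , skolem-reduction (skolem-∀∀∞ θ) (skolem-∀∀∞ _) y yᴾ _ sᴾ sᴾ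
      (λ x s _ H n m s≤m → trans (column-gather (h x) n m) (Holds⇒truth θ _ (H n m s≤m)))
      (λ x s _ H n m s≤m → truth⇒Holds θ _ (trans (sym (column-gather (h x) n m)) (H n m s≤m)))
  , skolem-reduction (skolem-∃∃∞ (~ θ)) (skolem-∃∃∞ _) y yᴾ _ sᴾ sᴾ
      (λ x s _ H k → proj₁ (H k) , λ eq →
        proj₂ (H k) (truth⇒Holds θ _ (trans (sym (column-gather (h x) _ _)) eq)))
      (λ x s _ H k → proj₁ (H k) , λ hθ →
        proj₂ (H k) (trans (column-gather (h x) _ _) (Holds⇒truth θ _ hθ)))
  where
  h : Tuple p q → ℕ → ω^ω
  h x n m = truth θ (m ◂ n ◂ x)

  y : Tuple p q → Tuple 0 1
  y x = gathered (h x)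

  xᴾ : Compω {n = 0} Instanceᴼ (λ x _ → encode x)
  xᴾ = oracleᴾ 0F

  yᴾ : Compω {n = 0} Instanceᴼ (λ x _ → encode (y x))
  yᴾ = gatheredᴾ h (lamᴾ (truthᴾ proj₂ (functionᴾ (λ x → x) xᴾ) θ
         ⟨ varᴾ 0F ∷ᴾ varᴾ 1F ∷ᴾ parametersᴾ (λ x → x) xᴾ ⟩))

  sᴾ : Compω {n = 0} (Skolemᴼ {p} {q}) (λ (s , _) _ → s)
  sᴾ = oracleᴾ 0F

-- The last nonzero value of a sequence

opaque
  -- 0 stands for no nonzero value below k, and suc j for the last one being at j.
  lastNonzero : ω^ω → ℕ → ℕ
  lastNonzero f = natrec 0 λ j r → natrec r (λ _ _ → suc j) (f j)

  lastNonzero-step : ∀ f k → (f k ≡ 0 × lastNonzero f (suc k) ≡ lastNonzero f k) ⊎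
                             (f k ≢ 0 × lastNonzero f (suc k) ≡ suc k)
  lastNonzero-step f k with f k
  ... | zero  = inj₁ (refl , refl)
  ... | suc _ = inj₂ ((λ ()) , refl)

  lastNonzero-≢0 : ∀ f k {l} → lastNonzero f k ≡ suc l → f l ≢ 0
  lastNonzero-≢0 f (suc k) eq with lastNonzero-step f k
  ... | inj₁ (_ , eq′)   = lastNonzero-≢0 f k (trans (sym eq′) eq)
  ... | inj₂ (fk≢0 , eq′) =
    subst (λ l → f l ≢ 0) (suc-injective (trans (sym eq′) eq)) fk≢0

  lastNonzero-upper : ∀ f k {j} → j < k → f j ≢ 0 → j < lastNonzero f k
  lastNonzero-upper f (suc k) {j} (s≤s j≤k) fj≢0 with lastNonzero-step f k | m≤n⇒m<n∨m≡n j≤k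
  ... | inj₁ (_ , eq)    | inj₁ j<k  = subst (j <_) (sym eq) (lastNonzero-upper f k j<k fj≢0)
  ... | inj₁ (fk≡0 , _)  | inj₂ refl = ⊥-elim (fj≢0 fk≡0)
  ... | inj₂ (_ , eq)    | _         = subst (j <_) (sym eq) (s≤s j≤k)

  lastNonzeroᴾ : Compω Φ G → Comp Φ F → Comp Φ (λ i v → lastNonzero (G i v) (F i v))
  lastNonzeroᴾ c d = natrecᴾ (constᴾ 0)
    (natrecᴾ (varᴾ 1F) (sucᴾ (varᴾ 2F)) (c ⟨ tailsᴾ ⟨ tailsᴾ ⟩s ⟩ω $ᴾ varᴾ 0F)) d

-- The strict inequality excludes the value 0, so `pred` undoes the shift and yields an actual
-- position.
lastNonzero-pred : ∀ f k {l} → l < lastNonzero f k →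
                   l ≤ pred (lastNonzero f k) × f (pred (lastNonzero f k)) ≢ 0
lastNonzero-pred f k l<last with lastNonzero f k | lastNonzero-≢0 f k
lastNonzero-pred f k (s≤s l≤last) | suc _ | ≢0 = l≤last , ≢0 refl

lastNonzero-≡0 : ∀ f k → lastNonzero f k ≡ 0 → ∀ j → j < k → f j ≡ 0
lastNonzero-≡0 f k eq j j<k with f j ≟ 0
... | yes fj≡0 = fj≡0
... | no fj≢0 with () ← subst (j <_) eq (lastNonzero-upper f k j<k fj≢0)

≡0-lastNonzero : ∀ f k → (∀ j → f j ≡ 0) → lastNonzero f k ≡ 0
≡0-lastNonzero f k f≡0 with lastNonzero f k in eq
... | zero  = refl
... | suc l = ⊥-elim (lastNonzero-≢0 f k eq (f≡0 l))

-- The candidate moves by one at a time, so that it cannot jump over a correct b.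
module Candidate (U : ℕ → ω^ω) where

  Correct : ℕ → Set
  Correct b = ∀ c → U b c ≡ 0

  opaque
    -- `U b c ≢ 0` means that `c` refutes `b`. Stage `k` looks for refutations below `k` only, and
    -- `1 ∸ (1 ∸ r)` turns the result into a step of 0 or 1.
    candidate : ω^ω
    candidate = natrec 0 λ k b → b + (1 ∸ (1 ∸ lastNonzero (U b) k))

    change : ω^ω
    change k = lastNonzero (U (candidate k)) k

    candidate-zero : candidate 0 ≡ 0
    candidate-zero = refl

    change≡0⇒ : ∀ k → change k ≡ 0 → ∀ c → c < k → U (candidate k) c ≡ 0
    change≡0⇒ k = lastNonzero-≡0 (U (candidate k)) k

    change≢0⇒ : ∀ k → change k ≢ 0 → lastNonzero (U (candidate k)) k ≢ 0
    change≢0⇒ k neq = neq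

    correct⇒unchanged : ∀ k → Correct (candidate k) → change k ≡ 0
    correct⇒unchanged k = ≡0-lastNonzero (U (candidate k)) k

    candidate-stay : ∀ k → change k ≡ 0 → candidate (suc k) ≡ candidate k
    candidate-stay k eq rewrite eq = +-identityʳ (candidate k)

    candidate-move : ∀ k → change k ≢ 0 → candidate (suc k) ≡ suc (candidate k)
    candidate-move k neq with change k
    ... | zero  = ⊥-elim (neq refl)
    ... | suc l rewrite 0∸n≡0 l = +-comm (candidate k) 1

  candidate-suc : ∀ k → candidate k ≤ candidate (suc k)
  candidate-suc k with change k ≟ 0
  ... | yes eq = ≤-reflexive (sym (candidate-stay k eq))
  ... | no neq = ≤-trans (n≤1+n _) (≤-reflexive (sym (candidate-move k neq)))

  candidate-mono : ∀ {j k} → j ≤ k → candidate j ≤ candidate k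
  candidate-mono {j} {zero} z≤n = ≤-refl
  candidate-mono {j} {suc k} j≤1+k with m≤n⇒m<n∨m≡n j≤1+k
  ... | inj₁ (s≤s j≤k) = ≤-trans (candidate-mono j≤k) (candidate-suc k)
  ... | inj₂ refl      = ≤-refl

  candidate-constant : ∀ {n} k → n ≤ k → (∀ j → n ≤ j → j < k → change j ≡ 0) →
                       candidate k ≡ candidate n
  candidate-constant zero z≤n h = refl
  candidate-constant (suc k) n≤1+k h with m≤n⇒m<n∨m≡n n≤1+k
  ... | inj₁ (s≤s n≤k) = trans (candidate-stay k (h k n≤k ≤-refl))
    (candidate-constant k n≤k λ j n≤j j<k → h j n≤j (m<n⇒m<1+n j<k))
  ... | inj₂ refl      = refl

  -- Any `c` is among the numbers tested at stage `suc (t + c)`, when the candidate is still the one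
  -- of stage `t`.
  correct-limit : ∀ t → (∀ k → t ≤ k → change k ≡ 0) → Correct (candidate t)
  correct-limit t h c = subst (λ b → U b c ≡ 0) constant
    (change≡0⇒ _ (h (suc (t + c)) t≤1+t+c) c (s≤s (m≤n+m c t)))
    where
    t≤1+t+c = m≤n⇒m≤1+n (m≤m+n t c)
    constant = candidate-constant (suc (t + c)) t≤1+t+c λ j t≤j _ → h j t≤j

  correct-stays : ∀ {t} → Correct (candidate t) → ∀ k → t ≤ k → Correct (candidate k)
  correct-stays correct zero z≤n = correct
  correct-stays correct (suc k) t≤1+k with m≤n⇒m<n∨m≡n t≤1+k
  ... | inj₂ refl = correct
  ... | inj₁ (s≤s t≤k) =
    let correct-k = correct-stays correct k t≤k in
    subst Correct (sym (candidate-stay k (correct⇒unchanged k correct-k))) correct-k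

  candidate-≤-correct : ∀ {b} → Correct b → ∀ k → candidate k ≤ b
  candidate-≤-correct {b} correct zero = subst (_≤ b) (sym candidate-zero) z≤n
  candidate-≤-correct {b} correct (suc k) with change k ≟ 0
  ... | yes eq = subst (_≤ b) (sym (candidate-stay k eq)) (candidate-≤-correct correct k)
  ... | no neq with m≤n⇒m<n∨m≡n (candidate-≤-correct correct k)
  ...   | inj₁ lt = subst (_≤ b) (sym (candidate-move k neq)) lt
  ...   | inj₂ eq = ⊥-elim (neq (correct⇒unchanged k (subst Correct (sym eq) correct)))

  -- w b refutes b unless b is correct; beyond all w b with b ≤ b₀ every
  -- incorrect candidate is given up at once.
  stabilisation : ω^ω → ℕ → ℕ
  stabilisation w b₀ = suc b₀ + sumBelow (suc b₀) (suc ∘ w)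

  stabilises : ∀ (w : ω^ω) → (∀ b → U b (w b) ≢ 0 ⊎ Correct b) → ∀ {b₀} → Correct b₀ →
               ∀ k → stabilisation w b₀ ≤ k → change k ≡ 0
  stabilises w refutes {b₀} correct k t≤k = correct⇒unchanged k (correct-stays correct-b k t≤k)
    where
    T = sumBelow (suc b₀) (suc ∘ w)

    -- Candidates never exceed the correct `b₀`, so the successors of their refutations are summands
    -- of `T`.
    w< : ∀ j → w (candidate (j + T)) < j + T
    w< j = ≤-trans (term≤sumBelow (suc b₀) (suc ∘ w) (s≤s (candidate-≤-correct correct (j + T))))
                   (m≤n+m T j)

    -- From stage `T` on the candidate moves at every stage until it is correct; `suc b₀` moves
    -- would take it beyond `b₀`.
    progress : ∀ j → j ≤ candidate (j + T) ⊎ Correct (candidate (j + T))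
    progress zero = inj₁ z≤n
    progress (suc j) with progress j
    ... | inj₂ correct-j = inj₂ (correct-stays correct-j (suc (j + T)) (n≤1+n _))
    ... | inj₁ j≤cand with refutes (candidate (j + T))
    ...   | inj₂ correct-j = inj₂ (correct-stays correct-j (suc (j + T)) (n≤1+n _))
    ...   | inj₁ refuted   = inj₁ (≤-trans (s≤s j≤cand)
            (≤-reflexive (sym (candidate-move (j + T) λ eq →
              refuted (change≡0⇒ (j + T) eq _ (w< j))))))

    correct-b : Correct (candidate (suc b₀ + T))
    correct-b with progress (suc b₀)
    ... | inj₁ b₀<cand = ⊥-elim (<⇒≱ b₀<cand (candidate-≤-correct correct _))
    ... | inj₂ correct-b = correct-b

  nextChange : ω^ω → ω^ω
  -- `lastNonzero` looks strictly below its bound, so the 2 makes stage `suc (w (candidate n) + n)`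
  -- the last one searched.
  nextChange w n = pred (lastNonzero change (2 + (w (candidate n) + n)))

  -- Without a change from stage `n` to stage `N`, the candidate at `N` would still be that of stage
  -- `n`, although its refutation, being below `N`, has been tested.
  nextChange-ok : ∀ w → (∀ b → U b (w b) ≢ 0) →
                  ∀ n → n ≤ nextChange w n × change (nextChange w n) ≢ 0
  nextChange-ok w refutes n with n <? lastNonzero change (2 + (w (candidate n) + n))
  ... | yes n<last = lastNonzero-pred change _ n<last
  ... | no  n≮last = ⊥-elim (refutes (candidate n)
          (subst (λ b → U b (w (candidate n)) ≡ 0)
            (candidate-constant N n≤N λ j n≤j j<N → unchanged j n≤j (m<n⇒m<1+n j<N))
            (change≡0⇒ N (unchanged N n≤N ≤-refl) _ (s≤s (m≤m+n _ n)))))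
    where
    N = suc (w (candidate n) + n)
    n≤N = m≤n⇒m≤1+n (m≤n+m n (w (candidate n)))

    unchanged : ∀ j → n ≤ j → j < suc N → change j ≡ 0
    unchanged j n≤j j<1+N with change j ≟ 0
    ... | yes eq = eq
    ... | no neq = ⊥-elim (n≮last (≤-<-trans n≤j (lastNonzero-upper change (suc N) j<1+N neq)))

  -- The candidate went past `b` by leaving it, at a stage where a refutation had been found; later
  -- stages search all the earlier numbers again.
  abandoned⇒refuted : ∀ k {b} → b < candidate k → lastNonzero (U b) k ≢ 0
  abandoned⇒refuted zero    {b} b<cand with () ← subst (b <_) candidate-zero b<cand
  abandoned⇒refuted (suc k) {b} b<cand = later (earlier b<cand)
    where
    later : lastNonzero (U b) k ≢ 0 → lastNonzero (U b) (suc k) ≢ 0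
    later neq eq with lastNonzero-step (U b) k
    ... | inj₁ (_ , eq′) = neq (trans (sym eq′) eq)
    ... | inj₂ (_ , eq′) with () ← trans (sym eq′) eq

    earlier : b < candidate (suc k) → lastNonzero (U b) k ≢ 0
    earlier b<cand with change k ≟ 0
    ... | yes eq = abandoned⇒refuted k (subst (b <_) (candidate-stay k eq) b<cand)
    ... | no neq with m≤n⇒m<n∨m≡n (≤-pred (subst (b <_) (candidate-move k neq) b<cand))
    ...   | inj₁ b<cand′ = abandoned⇒refuted k b<cand′
    ...   | inj₂ refl    = change≢0⇒ k neq

  -- Each step of the iteration passes one more change, so that b has been given up
  -- after suc b steps.
  refutation : ω^ω → ω^ω
  refutation t b = pred (lastNonzero (U b) (natrec 0 (λ _ k → suc (t k)) (suc b)))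

  refutation-ok : ∀ t → (∀ k → k ≤ t k × change (t k) ≢ 0) → ∀ b → U b (refutation t b) ≢ 0
  refutation-ok t h b = proj₂ (lastNonzero-pred (U b) K
    (n≢0⇒n>0 (abandoned⇒refuted K (candidate-iterate (suc b)))))
    where
    K = natrec 0 (λ _ k → suc (t k)) (suc b)

    candidate-iterate : ∀ j → j ≤ candidate (natrec 0 (λ _ k → suc (t k)) j)
    candidate-iterate zero    = z≤n
    candidate-iterate (suc j) = let k = natrec 0 (λ _ k → suc (t k)) j in
      ≤-trans (s≤s (≤-trans (candidate-iterate j) (candidate-mono (proj₁ (h k)))))
              (≤-reflexive (sym (candidate-move (t k) (proj₂ (h k)))))

open Candidate

-- Atomic reduces to the complete formula

kernel : ∀ {Q Q′ Q″} → Formula q (Q ∷ Q′ ∷ Q″ ∷ []) p → Bounded (3 + p) q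
kernel (_ ∙ _ ∙ _ ∙ matrix θ) = θ

atom : Bounded 4 2
atom = kernel (Problem.formula Atomic)

skolem-Atomic : Skolemization (Problem.formula Atomic)
skolem-Atomic = skolem-∀∃∀ atom

skolem-Atomic-dual : Skolemization (Problem.formula (dual Atomic))
skolem-Atomic-dual = skolem-∃∀∃ (~ atom)

opaque
  atomTruth : Tuple 1 2 → ℕ → ℕ → ω^ω
  atomTruth x a b c = truth atom (c ◂ b ◂ a ◂ x)

  atomTruth⇒Holds : ∀ {x a b c} → atomTruth x a b c ≡ 0 → Holds atom (c ◂ b ◂ a ◂ x)
  atomTruth⇒Holds {x} {a} {b} {c} = truth⇒Holds atom (c ◂ b ◂ a ◂ x)

  Holds⇒atomTruth : ∀ {x a b c} → Holds atom (c ◂ b ◂ a ◂ x) → atomTruth x a b c ≡ 0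
  Holds⇒atomTruth {x} {a} {b} {c} = Holds⇒truth atom (c ◂ b ◂ a ◂ x)

-- If s b is not strictly between ⊥ and b then b = s b, which is an atom.
skolem-refutes : ∀ {x s} → Skolem skolem-Atomic x s →
                 ∀ a b → atomTruth x a b (s b) ≢ 0 ⊎ Correct (atomTruth x a) b
skolem-refutes {⊥ ∷ [] , X ∷ R ∷ []} {s} sk a b with atomTruth (⊥ ∷ [] , X ∷ R ∷ []) a b (s b) ≟ 0
... | no  neq = inj₁ neq
... | yes eq  = inj₂ λ c → Holds⇒atomTruth λ a∈P →
    let b∈P , below = atomTruth⇒Holds eq a∈P
        -- That `s b` belongs to the order does not depend on the third quantifier, so the second
        -- `b` is arbitrary.
        sb∈P , _ = sk b b b∈P
    in b∈P , λ c∈P ⊥<a →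
      let ⊥<b≤a , sb-between = below sb∈P ⊥<a in
      ⊥<b≤a , λ (⊥<c , c<b) →
        let (⊥<sb , sb≤b) , c-between = proj₂ (sk b c b∈P) c∈P (proj₁ ⊥<b≤a)
        in sb-between (⊥<sb , sb≤b , λ sb≡b →
             c-between (⊥<c , subst (λ e → R (pair c e) ≡ 1 × ¬ c ≡ e) (sym sb≡b) c<b))

module _ {I : Set} {k} {Φ : I → Vec ω^ω k} (x : I → Tuple 1 2)
         (xᴾ : Compω {n = 0} Φ (λ i _ → encode (x i))) where

  opaque
    unfolding atomTruth candidate

    atomTruthᴾ : ∀ {n} {F₁ F₂ F₃ : I → Vec ℕ n → ℕ} → Comp Φ F₁ → Comp Φ F₂ → Comp Φ F₃ →
                 Comp Φ (λ i v → atomTruth (x i) (F₁ i v) (F₂ i v) (F₃ i v))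
    atomTruthᴾ a b c = truthᴾ (proj₂ ∘ x) (functionᴾ x xᴾ) atom
      ⟨ c ∷ᴾ b ∷ᴾ a ∷ᴾ parametersᴾ x xᴾ ⟩

    candidateᴾ : ∀ {n} {F₁ F₂ : I → Vec ℕ n → ℕ} → Comp Φ F₁ → Comp Φ F₂ →
                 Comp Φ (λ i v → candidate (atomTruth (x i) (F₁ i v)) (F₂ i v))
    candidateᴾ a k = natrecᴾ (constᴾ 0)
      (varᴾ 1F +ᴾ (constᴾ 1 ∸ᴾ (constᴾ 1 ∸ᴾ
        lastNonzeroᴾ (lamᴾ (atomTruthᴾ (↑ ↑ ↑ a) (varᴾ 2F) (varᴾ 0F))) (varᴾ 0F)))) k

    changeᴾ : ∀ {n} {F₁ F₂ : I → Vec ℕ n → ℕ} → Comp Φ F₁ → Comp Φ F₂ →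
              Comp Φ (λ i v → change (atomTruth (x i) (F₁ i v)) (F₂ i v))
    changeᴾ a k = lastNonzeroᴾ (lamᴾ (atomTruthᴾ (↑ a) (↑ candidateᴾ a k) (varᴾ 0F))) k

-- In the first reduction `s` has two uses: `s a` is correct for `a`, and `s b` is the refutation to
-- try against `b`. In the dual one `head s` is an element without an atom below it, so `tail s`
-- refutes every candidate.
Atomic≤ : Atomic ≤dm unrestricted everywhere0-eventually
Atomic≤ = codeω yᴾ
  , skolem-reduction skolem-Atomic (skolem-∀∀∞ _) y yᴾ _
      {r₋ = λ s x a → stabilisation (atomTruth x a) s (s a)}
      {r₊ = λ s x a → candidate (atomTruth x a) (s a)}
      (lamᴾ (sucᴾ (s $ᴾ varᴾ 0F) +ᴾ
        sumBelowᴾ (lamᴾ (sucᴾ (s $ᴾ varᴾ 0F))) (sucᴾ (s $ᴾ varᴾ 0F))))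
      (lamᴾ (candidateᴾ proj₂ xᴾ (varᴾ 0F) (s $ᴾ varᴾ 0F)))
      (λ x s _ sk a k t≤k → trans (column-gather (h x) a k)
        (stabilises (atomTruth x a) s (skolem-refutes {x} {s} sk a)
          (λ c → Holds⇒atomTruth (sk a c)) k t≤k))
      (λ x s _ sk a c → atomTruth⇒Holds
        (correct-limit (atomTruth x a) (s a)
          (λ k t≤k → trans (sym (column-gather (h x) a k)) (sk a k t≤k)) c))
  , skolem-reduction skolem-Atomic-dual (skolem-∃∃∞ _) y yᴾ _
      {r₋ = λ s x → cons (head s) (nextChange (atomTruth x (head s)) (tail s))}
      {r₊ = λ s x → cons (head s) (refutation (atomTruth x (head s)) (tail s))}
      (consᴾ (s $ᴾ constᴾ 0) (lamᴾ (predᴾ (lastNonzeroᴾ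
        (lamᴾ (changeᴾ proj₂ xᴾ (s $ᴾ constᴾ 0) (varᴾ 0F)))
        -- `tail s b` is `s (suc b)`, whence the successor in the argument.
        (constᴾ 2 +ᴾ ((s $ᴾ sucᴾ (candidateᴾ proj₂ xᴾ (s $ᴾ constᴾ 0) (varᴾ 0F))) +ᴾ varᴾ 0F))))))
      (consᴾ (s $ᴾ constᴾ 0) (lamᴾ (predᴾ (lastNonzeroᴾ
        (lamᴾ (atomTruthᴾ proj₂ xᴾ (s $ᴾ constᴾ 0) (varᴾ 1F) (varᴾ 0F)))
        (natrecᴾ (constᴾ 0) (sucᴾ (s $ᴾ sucᴾ (varᴾ 1F))) (sucᴾ (varᴾ 0F)))))))
      (λ x s _ sk k →
        let n≤k , changes = nextChange-ok (atomTruth x (head s)) (tail s)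
              (λ b eq → sk b (atomTruth⇒Holds eq)) k
        in n≤k , λ eq → changes (trans (sym (column-gather (h x) _ _)) eq))
      (λ x s _ sk b at → refutation-ok (atomTruth x (head s)) (tail s)
        (λ k → proj₁ (sk k) , λ eq → proj₂ (sk k) (trans (column-gather (h x) _ _) eq))
        b (Holds⇒atomTruth at))
  where
  h : Tuple 1 2 → ℕ → ω^ω
  h x a = change (atomTruth x a)

  y : Tuple 1 2 → Tuple 0 1
  y x = gathered (h x)

  yᴾ : Compω {n = 0} Instanceᴼ (λ x _ → encode (y x))
  yᴾ = gatheredᴾ h (lamᴾ (changeᴾ (λ x → x) (oracleᴾ 0F) (varᴾ 1F) (varᴾ 0F)))

  s : ∀ {n} → Compω {n = n} (Skolemᴼ {1} {2}) (λ (s , _) _ → s)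
  s = oracleᴾ 0F

  xᴾ : Compω {n = 0} (Skolemᴼ {1} {2}) (λ (_ , x) _ → encode x)
  xᴾ = oracleᴾ 1F

-- The complete formula reduces to Atomic

-- The order has the bottom element 0 and, for each n, a descending chain whose
-- elements are node n 0 and the node n (suc m) with f ⟨ n , m ⟩ ≢ 0.
node : ℕ → ℕ → ℕ
node n m = suc (pair n m)

chain depth : ℕ → ℕ
chain u = unpair₁ (pred u)
depth u = unpair₂ (pred u)

chain-node : ∀ n m → chain (node n m) ≡ n
chain-node = unpair₁-pair

depth-node : ∀ n m → depth (node n m) ≡ m
depth-node = unpair₂-pair

node-chain-depth : ∀ {u} → u ≢ 0 → node (chain u) (depth u) ≡ u
node-chain-depth {zero}  u≢0 = ⊥-elim (u≢0 refl)
node-chain-depth {suc u} _   = cong suc (pair-unpair u)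

chain-depth-injective : ∀ {u v} → u ≢ 0 → v ≢ 0 → chain u ≡ chain v → depth u ≡ depth v → u ≡ v
chain-depth-injective u≢0 v≢0 chain≡ depth≡ =
  trans (sym (node-chain-depth u≢0)) (trans (cong₂ node chain≡ depth≡) (node-chain-depth v≢0))

1∸n≡1⇒n≡0 : ∀ n → 1 ∸ n ≡ 1 → n ≡ 0
1∸n≡1⇒n≡0 zero    _  = refl
1∸n≡1⇒n≡0 (suc n) eq with () ← trans (sym (0∸n≡0 n)) eq

1∸n-bit : ∀ n → 1 ∸ n ≡ 0 ⊎ 1 ∸ n ≡ 1
1∸n-bit zero    = inj₂ refl
1∸n-bit (suc n) = inj₁ (0∸n≡0 n)

infix 4 _⊑_
-- The order on all conceivable nodes, greater depth being lower. The premise puts 0 below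
-- everything; `R` then restricts the order to the elements present.
_⊑_ : ℕ → ℕ → Set
u ⊑ v = u ≢ 0 → v ≢ 0 × chain u ≡ chain v × depth v ≤ depth u

⊑-trans : ∀ {u v w} → u ⊑ v → v ⊑ w → u ⊑ w
⊑-trans u⊑v v⊑w u≢0 =
  let v≢0 , chain≡ , v≤u = u⊑v u≢0
      w≢0 , chain≡′ , w≤v = v⊑w v≢0
  in w≢0 , trans chain≡ chain≡′ , ≤-trans w≤v v≤u

⊑-antisym : ∀ {u v} → u ⊑ v → v ⊑ u → u ≡ v
⊑-antisym {zero}  {zero}  _   _   = refl
⊑-antisym {zero}  {suc v} _   v⊑u = ⊥-elim (proj₁ (v⊑u λ ()) refl)
⊑-antisym {suc u} {zero}  u⊑v _   = ⊥-elim (proj₁ (u⊑v λ ()) refl)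
⊑-antisym {suc u} {suc v} u⊑v v⊑u =
  let v≢0 , chain≡ , v≤u = u⊑v λ ()
      u≢0 , _ , u≤v = v⊑u λ ()
  in chain-depth-injective u≢0 v≢0 chain≡ (≤-antisym u≤v v≤u)

bottom-⊑ : ∀ {u} → 0 ⊑ u
bottom-⊑ 0≢0 = ⊥-elim (0≢0 refl)

-- A number vanishing exactly if `u ⊑ v`; the factor `u` accounts for the premise `u ≢ 0`.
notBelow : ℕ → ω^ω
notBelow u v = u * ((1 ∸ v) + ((chain u ∸ chain v) + (chain v ∸ chain u)) + (depth v ∸ depth u))

notBelow⇒ : ∀ u v → notBelow u v ≡ 0 → u ⊑ v
notBelow⇒ u v eq u≢0 with m*n≡0⇒m≡0∨n≡0 u eq
... | inj₁ u≡0 = ⊥-elim (u≢0 u≡0)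
... | inj₂ eq′ =
    1∸n≡0⇒n≢0 (m+n≡0⇒m≡0 (1 ∸ v) left)
  , ≤-antisym (m∸n≡0⇒m≤n (m+n≡0⇒m≡0 (chain u ∸ chain v) chains))
              (m∸n≡0⇒m≤n (m+n≡0⇒n≡0 (chain u ∸ chain v) chains))
  , m∸n≡0⇒m≤n (m+n≡0⇒n≡0 _ eq′)
  where
  left = m+n≡0⇒m≡0 ((1 ∸ v) + ((chain u ∸ chain v) + (chain v ∸ chain u))) eq′
  chains = m+n≡0⇒n≡0 (1 ∸ v) left

⇒notBelow : ∀ u v → u ⊑ v → notBelow u v ≡ 0
⇒notBelow zero    v _   = refl
⇒notBelow (suc u) v u⊑v with v≢0 , chain≡ , v≤u ← u⊑v (λ ())
  rewrite n≢0⇒1∸n≡0 v≢0 | chain≡ | n∸n≡0 (chain v) | m≤n⇒m∸n≡0 v≤u = *-zeroʳ u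

module Chains (f : ω^ω) where

  onChain : ℕ → ω^ω
  onChain n m = f (pair n m)

  -- Depth 0 imposes no condition, so every chain has a top element even if its sequence vanishes.
  Present : ℕ → Set
  Present u = u ≢ 0 → ∀ j → depth u ≡ suc j → onChain (chain u) j ≢ 0

  bottom-present : Present 0
  bottom-present 0≢0 = ⊥-elim (0≢0 refl)

  absent : ω^ω
  absent u = u * (depth u * (1 ∸ onChain (chain u) (pred (depth u))))

  absent⇒ : ∀ u → absent u ≡ 0 → Present u
  absent⇒ u eq u≢0 j depth≡ with m*n≡0⇒m≡0∨n≡0 u eq
  ... | inj₁ u≡0 = ⊥-elim (u≢0 u≡0)
  ... | inj₂ eq′ with m*n≡0⇒m≡0∨n≡0 (depth u) eq′
  ...   | inj₁ depth≡0 with () ← trans (sym depth≡) depth≡0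
  ...   | inj₂ eq″ rewrite depth≡ = 1∸n≡0⇒n≢0 eq″

  ⇒absent : ∀ u → Present u → absent u ≡ 0
  ⇒absent zero    _ = refl
  ⇒absent (suc u) present with depth (suc u) | present (λ ())
  ... | zero  | _  = *-zeroʳ u
  ... | suc j | ≢0 rewrite n≢0⇒1∸n≡0 (≢0 j refl) | *-zeroʳ j = *-zeroʳ u

  opaque
    X R : ω^ω
    X u = 1 ∸ absent u
    R k = 1 ∸ (absent (unpair₁ k) + absent (unpair₂ k) + notBelow (unpair₁ k) (unpair₂ k))

    X-bit : ∀ u → X u ≡ 0 ⊎ X u ≡ 1
    X-bit u = 1∸n-bit (absent u)

    R-bit : ∀ k → R k ≡ 0 ⊎ R k ≡ 1
    R-bit k = 1∸n-bit (absent (unpair₁ k) + absent (unpair₂ k) + notBelow (unpair₁ k) (unpair₂ k))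

    X⇒ : ∀ {u} → X u ≡ 1 → Present u
    X⇒ {u} eq = absent⇒ u (1∸n≡1⇒n≡0 (absent u) eq)

    ⇒X : ∀ {u} → Present u → X u ≡ 1
    ⇒X {u} present rewrite ⇒absent u present = refl

    R⇒ : ∀ {u v} → R (pair u v) ≡ 1 → Present u × Present v × u ⊑ v
    R⇒ {u} {v} eq rewrite unpair-pair u v =
        absent⇒ u (m+n≡0⇒m≡0 (absent u) both)
      , absent⇒ v (m+n≡0⇒n≡0 (absent u) both)
      , notBelow⇒ u v (m+n≡0⇒n≡0 (absent u + absent v) sum)
      where
      sum : absent u + absent v + notBelow u v ≡ 0
      sum = 1∸n≡1⇒n≡0 (absent u + absent v + notBelow u v) eq
      both : absent u + absent v ≡ 0
      both = m+n≡0⇒m≡0 (absent u + absent v) sum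

    ⇒R : ∀ {u v} → Present u → Present v → u ⊑ v → R (pair u v) ≡ 1
    ⇒R {u} {v} present present′ u⊑v
      rewrite unpair-pair u v | ⇒absent u present | ⇒absent v present′ | ⇒notBelow u v u⊑v = refl

  isPointedPoset : IsPointedPoset 0 X R
  isPointedPoset = record
    { X-char = X-bit
    ; R-char = λ a b → R-bit (pair a b)
    ; R⊆X²   = λ a b eq → let pa , pb , _ = R⇒ eq in ⇒X pa , ⇒X pb
    ; isPartialOrder = record
      { isPreorder = record
        { isEquivalence = record { refl = refl ; sym = sym ; trans = trans }
        ; reflexive = λ { {u , u∈X} {_ , _} refl → ⇒R (X⇒ u∈X) (X⇒ u∈X) λ u≢0 → u≢0 , refl , ≤-refl }
        ; trans = λ {(u , _)} {(v , _)} {(w , _)} u≤v v≤w →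
            let pu , _ , u⊑v = R⇒ {u} {v} u≤v
                _ , pw , v⊑w = R⇒ {v} {w} v≤w
            in ⇒R pu pw (⊑-trans u⊑v v⊑w)
        }
      ; antisym = λ {(u , _)} {(v , _)} u≤v v≤u →
          ⊑-antisym (proj₂ (proj₂ (R⇒ {u} {v} u≤v))) (proj₂ (proj₂ (R⇒ {v} {u} v≤u)))
      }
    ; ⊥∈X     = ⇒X bottom-present
    ; minimum = λ (u , u∈X) → ⇒R bottom-present (X⇒ u∈X) bottom-⊑
    }

  structure : Tuple 1 2
  structure = (0 ∷ []) , (X ∷ R ∷ [])

  AtomBelow : ℕ → ℕ → ℕ → Set
  AtomBelow a b c = Holds atom (c ◂ b ◂ a ◂ structure)

  -- The lowest element of chain `n` that comes from positions below `k`: the shift in `lastNonzero`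
  -- is the one in `node n (suc m)`, and 0 gives the top.
  last : ℕ → ω^ω
  last n k = node n (lastNonzero (onChain n) k)

  node-zero-present : ∀ n → Present (node n 0)
  node-zero-present n _ j eq with () ← trans (sym eq) (depth-node n 0)

  node-suc-present : ∀ n m → onChain n m ≢ 0 → Present (node n (suc m))
  node-suc-present n m ≢0 _ j eq
    rewrite chain-node n (suc m) | suc-injective (trans (sym eq) (depth-node n (suc m))) = ≢0

  last-present : ∀ n k → Present (last n k)
  last-present n k _ j eq rewrite chain-node n (lastNonzero (onChain n) k) =
    lastNonzero-≢0 (onChain n) k (trans (sym (depth-node n _)) eq)

  depth≤last : ∀ {u} k → u ≢ 0 → Present u → (∀ m → k ≤ m → onChain (chain u) m ≡ 0) →
               depth u ≤ lastNonzero (onChain (chain u)) k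
  depth≤last {u} k u≢0 present vanish with depth u
  ... | zero  = z≤n
  ... | suc j = lastNonzero-upper (onChain (chain u)) k
    (≰⇒> (present u≢0 j refl ∘ vanish j)) (present u≢0 j refl)

  -- The first bound puts the last node at or below `a`; the second leaves no room for `c` strictly
  -- below that node. Only the given `c` is bounded, so that the contrapositive says something about
  -- a single counterexample.
  last-below : ∀ a k c → let l = lastNonzero (onChain (chain a)) k in
               (a ≢ 0 → Present a → depth a ≤ l) →
               (c ≢ 0 → Present c → chain c ≡ chain a → depth c ≤ l) →
               AtomBelow a (last (chain a) k) c
  last-below a k c a≤l c≤l a∈P = ⇒X b-present , λ c∈P (⊥≤a , 0≢a) →
      ((⇒R bottom-present b-present bottom-⊑ , λ ())
      , ⇒R b-present (X⇒ a∈P) λ _ → 0≢a ∘ sym , chain-node _ _ ,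
          ≤-trans (a≤l (0≢a ∘ sym) (X⇒ a∈P)) (≤-reflexive (sym b-depth)))
    , λ ((_ , 0≢c) , c≤b , c≢b) →
        let _ , _ , c⊑b = R⇒ c≤b
            b≢0 , chain≡ , b≤c = c⊑b (0≢c ∘ sym)
            c≤b′ = ≤-trans (c≤l (0≢c ∘ sym) (X⇒ c∈P) (trans chain≡ (chain-node _ _)))
                           (≤-reflexive (sym b-depth))
        in c≢b (chain-depth-injective (0≢c ∘ sym) b≢0 chain≡ (≤-antisym c≤b′ b≤c))
    where
    b-present : Present (last (chain a) k)
    b-present = last-present (chain a) k

    b-depth : depth (last (chain a) k) ≡ lastNonzero (onChain (chain a)) k
    b-depth = depth-node (chain a) _

  last-atom : ∀ (t : ω^ω) → (∀ i m → t i ≤ m → onChain i m ≡ 0) →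
              ∀ a c → AtomBelow a (last (chain a) (t (chain a))) c
  last-atom t vanish a c = last-below a (t (chain a)) c
    (λ a≢0 present → depth≤last (t (chain a)) a≢0 present (vanish (chain a)))
    (λ c≢0 present chain≡ → subst (λ i → depth c ≤ lastNonzero (onChain i) (t i)) chain≡
      (depth≤last (t (chain c)) c≢0 present (vanish (chain c))))

  -- A `b` above the bottom and below the top of chain `n` is on this chain, so `node n (suc m)`,
  -- being deeper, is strictly between the bottom and `b`.
  no-atom : ∀ n m b → onChain n m ≢ 0 → depth b ≤ m → ¬ AtomBelow (node n 0) b (node n (suc m))
  no-atom n m b ≢0 b≤m below =
    let b∈P , below′ = below (⇒X (node-zero-present n))
        ((⊥≤b , 0≢b) , b≤a) , not-between = below′ (⇒X c-present)
          (⇒R bottom-present (node-zero-present n) bottom-⊑ , λ ())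
        _ , chain-b≡ , _ = proj₂ (proj₂ (R⇒ b≤a)) (0≢b ∘ sym)
        c-depth = depth-node n (suc m)
    in not-between
      ( (⇒R bottom-present c-present bottom-⊑ , λ ())
      , ⇒R c-present (X⇒ b∈P) (λ _ → 0≢b ∘ sym
          , trans (chain-node n (suc m)) (sym (trans chain-b≡ (chain-node n 0)))
          , ≤-trans b≤m (≤-trans (n≤1+n m) (≤-reflexive (sym c-depth))))
      , λ c≡b → <⇒≱ (≤-reflexive (sym c-depth)) (subst (λ e → depth e ≤ m) (sym c≡b) b≤m))
    where
    c-present : Present (node n (suc m))
    c-present = node-suc-present n m ≢0

  -- A counterexample must be deeper than the last node, hence comes from a position not below
  -- `k + depth a`. The summand `depth a` ensures that the last node is at or below `a` itself.
  deeper : ∀ a k c → ¬ AtomBelow a (last (chain a) (k + depth a)) c →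
           k ≤ pred (depth c) × onChain (chain a) (pred (depth c)) ≢ 0
  deeper a k c not-below = decidable-stable
    ((k ≤? pred (depth c)) ×-dec ¬? (onChain (chain a) (pred (depth c)) ≟ 0))
    λ not-deeper → not-below (last-below a (k + depth a) c a-depth
      λ c≢0 present chain≡ → ≮⇒≥ (not-deeper ∘ beyond-last c≢0 present chain≡))
    where
    l : ℕ
    l = lastNonzero (onChain (chain a)) (k + depth a)

    a-depth : a ≢ 0 → Present a → depth a ≤ l
    a-depth a≢0 present with depth a
    ... | zero  = z≤n
    ... | suc j = lastNonzero-upper (onChain (chain a)) _ (m≤n+m (suc j) k) (present a≢0 j refl)

    beyond-last : c ≢ 0 → Present c → chain c ≡ chain a → l < depth c →
                  k ≤ pred (depth c) × onChain (chain a) (pred (depth c)) ≢ 0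
    beyond-last c≢0 present chain≡ l<depth with depth c
    ... | suc j = ≮⇒≥ (λ j<k → <⇒≱ l<depth
                    (lastNonzero-upper (onChain (chain a)) _ (≤-trans j<k (m≤m+n k (depth a))) ≢0))
                , ≢0
      where
      ≢0 : onChain (chain a) j ≢ 0
      ≢0 = subst (λ i → onChain i j ≢ 0) chain≡ (present c≢0 j refl)

-- Computability of the order made of chains

chainᴾ : Comp Φ F → Comp Φ (λ i v → chain (F i v))
chainᴾ c = unpair₁ᴾ (predᴾ c)

depthᴾ : Comp Φ F → Comp Φ (λ i v → depth (F i v))
depthᴾ c = unpair₂ᴾ (predᴾ c)

notBelowᴾ : Comp Φ F₁ → Comp Φ F₂ → Comp Φ (λ i v → notBelow (F₁ i v) (F₂ i v))
notBelowᴾ c d = c *ᴾ ((constᴾ 1 ∸ᴾ d)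
  +ᴾ ((chainᴾ c ∸ᴾ chainᴾ d) +ᴾ (chainᴾ d ∸ᴾ chainᴾ c)) +ᴾ (depthᴾ d ∸ᴾ depthᴾ c))

module _ {I : Set} {k} {Φ : I → Vec ω^ω k} (f : I → ω^ω)
         (fᴾ : Compω {n = 0} Φ (λ i _ → f i)) where

  open Chains

  lastᴾ : ∀ {n} {F₁ F₂ : I → Vec ℕ n → ℕ} → Comp Φ F₁ → Comp Φ F₂ →
          Comp Φ (λ i v → last (f i) (F₁ i v) (F₂ i v))
  lastᴾ c d = sucᴾ (pairᴾ c (lastNonzeroᴾ (lamᴾ (fᴾ ⟨ []ᴾ ⟩ω $ᴾ pairᴾ (↑ c) (varᴾ 0F))) d))

  absentᴾ : ∀ {n} {F : I → Vec ℕ n → ℕ} → Comp Φ F → Comp Φ (λ i v → absent (f i) (F i v))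
  absentᴾ c = c *ᴾ (depthᴾ c *ᴾ (constᴾ 1 ∸ᴾ
    (fᴾ ⟨ []ᴾ ⟩ω $ᴾ pairᴾ (chainᴾ c) (predᴾ (depthᴾ c)))))

  opaque
    unfolding X

    Xᴾ : Compω {n = 0} Φ (λ i _ → X (f i))
    Xᴾ = lamᴾ (constᴾ 1 ∸ᴾ absentᴾ (varᴾ 0F))

    Rᴾ : Compω {n = 0} Φ (λ i _ → R (f i))
    Rᴾ = lamᴾ (constᴾ 1 ∸ᴾ (absentᴾ u +ᴾ absentᴾ v +ᴾ notBelowᴾ u v))
      where
      u : Comp {n = 1} Φ (λ _ w → unpair₁ (lookup w 0F))
      u = unpair₁ᴾ (varᴾ 0F)

      v : Comp {n = 1} Φ (λ _ w → unpair₂ (lookup w 0F))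
      v = unpair₂ᴾ (varᴾ 0F)

-- Position `m` gives a node of depth `suc m`, so the depth of an atom below the top of chain `n`
-- bounds the nonzero positions. In the dual, a nonzero position from `depth b` on refutes `b`;
-- conversely, refuting the last node for larger and larger bounds produces nonzero positions
-- arbitrarily far out.
≤Atomic : unrestricted everywhere0-eventually ≤dm Atomic
≤Atomic = codeω yᴾ
  , skolem-reduction (skolem-∀∀∞ _) skolem-Atomic y yᴾ (λ x _ → Chains.isPointedPoset (f x))
      {r₋ = λ s x a → Chains.last (f x) (chain a) (s (chain a))}
      {r₊ = λ s x n → depth (s (node n 0))}
      (lamᴾ (lastᴾ (f ∘ proj₂) fᴾ (chainᴾ (varᴾ 0F)) (s $ᴾ chainᴾ (varᴾ 0F))))
      (lamᴾ (depthᴾ (s $ᴾ sucᴾ (pairᴾ (varᴾ 0F) (constᴾ 0)))))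
      (λ x s _ vanish → Chains.last-atom (f x) s vanish)
      (λ x s _ sk n m b≤m → decidable-stable (_ ≟ 0) λ ≢0 →
        Chains.no-atom (f x) n m _ ≢0 b≤m (sk (node n 0) (node n (suc m))))
  , skolem-reduction (skolem-∃∃∞ _) skolem-Atomic-dual y yᴾ (λ x _ → Chains.isPointedPoset (f x))
      {r₋ = λ s x → cons (node (head s) 0) (λ b → node (head s) (suc (tail s (depth b))))}
      {r₊ = λ s x → cons (chain (head s)) (λ k → pred (depth
        (tail s (Chains.last (f x) (chain (head s)) (k + depth (head s))))))}
      (consᴾ (sucᴾ (pairᴾ (s $ᴾ constᴾ 0) (constᴾ 0)))
        (lamᴾ (sucᴾ (pairᴾ (s $ᴾ constᴾ 0) (sucᴾ (s $ᴾ sucᴾ (depthᴾ (varᴾ 0F))))))))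
      (consᴾ (chainᴾ (s $ᴾ constᴾ 0)) (lamᴾ (predᴾ (depthᴾ
        (s $ᴾ sucᴾ (lastᴾ (f ∘ proj₂) fᴾ (chainᴾ (s $ᴾ constᴾ 0))
          (varᴾ 0F +ᴾ depthᴾ (s $ᴾ constᴾ 0))))))))
      (λ x s _ sk b → Chains.no-atom (f x) (head s) _ b (proj₂ (sk (depth b))) (proj₁ (sk (depth b))))
      (λ x s _ sk k → Chains.deeper (f x) (head s) k _ (sk _))
  where
  f : Tuple 0 1 → ω^ω
  f x = lookup (proj₂ x) 0F

  y : Tuple 0 1 → Tuple 1 2
  y x = Chains.structure (f x)

  yᴾ : Compω {n = 0} Instanceᴼ (λ x _ → encode (y x))
  yᴾ = encodeᴾ y (λ { 0F → constᴾ 0 })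
    (λ { 0F → Xᴾ f (functionᴾ (λ x → x) (oracleᴾ 0F) 0F)
       ; 1F → Rᴾ f (functionᴾ (λ x → x) (oracleᴾ 0F) 0F) })

  s : ∀ {n} → Compω {n = n} (Skolemᴼ {0} {1}) (λ (s , _) _ → s)
  s = oracleᴾ 0F

  fᴾ : Compω {n = 0} (Skolemᴼ {0} {1}) (λ (_ , x) _ → f x)
  fᴾ = functionᴾ proj₂ (oracleᴾ 1F) 0F

theorem3p14 : Dicomplete (∀′ ∷ ∀∞ ∷ []) Atomic
theorem3p14 =
  1 , 0 , everywhere0-eventually , everywhere0-eventually-complete , Atomic≤ , ≤Atomic
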